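{- There is an absolute constant $c>0$ such that the following holds. Let $G$ be a $d$-regular graph with $n$ vertices, where $1\le d\le n/2$, and suppose $G$ has exactly $d^3/6+s$ triangles (so $s$ is a real number, possibly negative). (i) If $s<-nd^{3/2}$, then $\mathrm{sp}(G)\ge c\,|s|/d$. (ii) If $-nd^{3/2}\le s\le nd^{3/2}$, then $\mathrm{sp}(G)\ge c\, n d^{1/2}$. (iii) If $s>nd^{3/2}$, then $\mathrm{sp}(G)\ge c\, n^2d^2/s$.
   Context: All graphs are finite and simple. $\mathrm{mc}(G)$ denotes the maximum number of edges crossing a partition of $V(G)$ into two parts, and the surplus of $G$ is $\mathrm{sp}(G)=\mathrm{mc}(G)-e(G)/2$, where $e(G)$ is the number of edges. -}

module Defs where

open import Data.Bool using (Bool; true; false; if_then_else_; _∧_; _xor_)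
open import Data.Nat using (ℕ; zero; suc; _+_; _⊔_)
open import Data.Fin using (Fin; zero; suc; _<?_)
open import Data.Vec using (Vec; []; _∷_; lookup)
open import Data.List using (List; []; _∷_; map; _++_; foldr)
open import Data.Integer using (+_)
open import Relation.Nullary.Decidable using (⌊_⌋)
open import Relation.Binary.PropositionalEquality using (_≡_)
import Data.Rational as ℚ
open ℚ using (ℚ)

record Graph (n : ℕ) : Set where
  field
    adj    : Fin n → Fin n → Bool
    sym    : ∀ u v → adj u v ≡ adj v u
    irrefl : ∀ v → adj v v ≡ false
open Graph public

sumF : ∀ {n} → (Fin n → ℕ) → ℕ
sumF {zero}  f = 0
sumF {suc n} f = f zero + sumF (λ i → f (suc i))

𝟙 : Bool → ℕ
𝟙 b = if b then 1 else 0

_<ᵇ_ : ∀ {n} → Fin n → Fin n → Bool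
i <ᵇ j = ⌊ i <? j ⌋

degree : ∀ {n} → Graph n → Fin n → ℕ
degree G v = sumF λ u → 𝟙 (adj G v u)

IsRegular : ∀ {n} → Graph n → ℕ → Set
IsRegular G d = ∀ v → degree G v ≡ d

edges : ∀ {n} → Graph n → ℕ
edges G = sumF λ i → sumF λ j → 𝟙 (i <ᵇ j ∧ adj G i j)

triangles : ∀ {n} → Graph n → ℕ
triangles G = sumF λ i → sumF λ j → sumF λ k →
  𝟙 (i <ᵇ j ∧ j <ᵇ k ∧ adj G i j ∧ adj G j k ∧ adj G i k)

-- a bipartition V = X ∪ (V∖X) is given by a Boolean vector (true = in X)
Partition : ℕ → Set
Partition n = Vec Bool n

cut : ∀ {n} → Graph n → Partition n → ℕ
cut G P = sumF λ i → sumF λ j →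
  𝟙 (i <ᵇ j ∧ adj G i j ∧ (lookup P i xor lookup P j))

allPartitions : (n : ℕ) → List (Partition n)
allPartitions zero    = [] ∷ []
allPartitions (suc n) = map (true ∷_) (allPartitions n) ++ map (false ∷_) (allPartitions n)

mc : ∀ {n} → Graph n → ℕ
mc {n} G = foldr (λ P m → cut G P ⊔ m) 0 (allPartitions n)

ℕ→ℚ : ℕ → ℚ
ℕ→ℚ k = (+ k) ℚ./ 1

sp : ∀ {n} → Graph n → ℚ
sp G = ℕ→ℚ (mc G) ℚ.- ((+ edges G) ℚ./ 2)

sParam : ∀ {n} → Graph n → ℕ → ℚ
sParam G d = ℕ→ℚ (triangles G) ℚ.- ((+ (d Data.Nat.* d Data.Nat.* d)) ℚ./ 6)
  where import Data.Nat

-- The surplus is the maximum of -¼ pᵀAp over p ∈ [-1, 1]ⁿ, A being the adjacency matrix. Put K = A/d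
-- and let M be the Gram matrix of the vectors x_v = (I - K)(I - hK) e_v, where 0 ≤ h ≤ √d. The factor
-- I - K removes the trivial eigenvalue and supplies a gain h² tr K⁴(I - K) in -tr KM, so that with
-- S = 6s/d³ = tr K³ - 1 and Y = tr K²(I - K)² one has
--     -tr KM ≥ n/d + 2hY - h²S + h² tr K⁴(I - K),    Y ≥ max(0, n/2d - 2S).
-- A logarithmic loss in rounding the x_v is avoided as follows: for random signs g_j the variables
-- Im ∏_j (1 + i g_j x_v(j)), suitably scaled, are bounded and have correlations M_uv + O(M_uv²), and
-- Σ M_uv² = tr M² is absorbed by n and the above gain. Hence sp(G) ≥ c d (n/2d + 2hY - h²S). Then
-- h ~ √d gives (i) and (ii), and h = nd²/48s gives (iii).
module Submission where

open import Defs
open import Data.Nat using (ℕ; zero; suc; z≤n; s≤s; _⊔_) renaming (_≤_ to _≤ℕ_; _*_ to _*ℕ_; _+_ to _+ℕ_)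
import Data.Nat.Properties as ℕ
open import Data.Fin using (Fin; zero; suc; _<?_)
import Data.Integer as ℤ
import Data.Integer.Properties as ℤ
open import Data.Bool using (Bool; true; false; _∧_; _xor_)
open import Data.Vec using (Vec; lookup) renaming ([] to []ᵥ; _∷_ to _∷ᵥ_)
open import Data.List.Membership.Propositional using (_∈_)
open import Data.List.Membership.Propositional.Properties using (∈-++⁺ˡ; ∈-++⁺ʳ; ∈-map⁺)
open import Data.List.Relation.Unary.Any using (here; there)
open import Data.List using (List; []; _∷_; _++_; tabulate; foldr) renaming (map to mapₗ)
open import Data.Empty using (⊥-elim)
open import Data.Maybe using (Maybe; just; nothing)
open import Data.Product using (∃; _×_; _,_; proj₁; proj₂)
open import Data.Sum using (_⊎_; inj₁; inj₂)
open import Data.Rational using (ℚ; 0ℚ; 1ℚ; ½; _<_; _≤_; _*_; _+_; _-_; -_; ∣_∣; _/_; 1/_; positive; nonNegative; toℚᵘ)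
open import Data.Rational.Properties as ℚ using (≤-refl; ≤-trans; ≤-reflexive)
open import Data.Rational.Unnormalised using (mkℚᵘ)
import Data.Rational.Unnormalised as ℚᵘ
import Data.Rational.Unnormalised.Properties as ℚᵘ
open import Relation.Nullary using (Dec; yes; no)
open import Relation.Nullary.Decidable using (True; toWitness; isYes≗does)
open import Relation.Binary.PropositionalEquality as ≡ using (_≡_; refl; trans; cong; cong₂; subst; subst₂)
open import Algebra.Bundles using (CommutativeRing)
open CommutativeRing ℚ.+-*-commutativeRing using (semiring)
open import Algebra.Properties.Semiring.Sum semiring using (sum; sum-cong-≗; ∑-distrib-+; ∑-comm; *-distribˡ-sum)
open import Algebra.Properties.Semiring.Exp semiring using (_^_)
open import Tactic.RingSolver.Core.AlmostCommutativeRing using (AlmostCommutativeRing; fromCommutativeRing)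
open import Tactic.RingSolver using (solve-∀)
open import Agda.Builtin.FromNat using (Number; fromNat)
open import Data.Unit using (tt)
import Data.Rational.Literals as ℚ-literals
import Data.Nat.Literals as ℕ-literals

-- Everything stays inside ℚ: no eigenvalue, complex number or probability space occurs. A trace is
-- a sum over vertices of inner products of iterates of `T` on unit vectors, and each fact about a
-- spectrum in [-1, 1] is derived from the contraction `⟨ T z , T z ⟩ ≤ ⟨ z , z ⟩`. The eigenvalue 1
-- enters only as tr K⁴ ≥ 1, which is Cauchy-Schwarz for the rows of K². The root of d is replaced
-- by a rational r with r² ≤ d ≤ 4r². The delicate point is the quadratic error of the rounding. It
-- is a multiple of Σ K_uv M_uv², which is at most (1/d) tr M² because the entries of K are at most
-- 1/d. The term of M² of highest degree in h is h⁴ K⁴(I - K)⁴, and (1 - λ)⁴ ≤ 8(1 - λ) on [-1, 1].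
-- Its share of the error is thus at most a constant times (h²/d) h² tr K⁴(I - K), comparable with
-- the gain as long as h² ≤ d; this is the reason for the range of h. Scaling the vectors by δ
-- multiplies the gain by δ² and the error by δ⁴, so a small fixed δ decides the comparison.

instance
  ℕ-number : Number ℕ
  ℕ-number = ℕ-literals.number

  ℚ-number : Number ℚ
  ℚ-number = ℚ-literals.number

ℚ-ring : AlmostCommutativeRing _ _
ℚ-ring = fromCommutativeRing ℚ.+-*-commutativeRing λ x → decToMaybe (0ℚ ℚ.≟ x)
  where
  decToMaybe : ∀ {x} → Dec (0ℚ ≡ x) → Maybe (0ℚ ≡ x)
  decToMaybe (yes p) = just p
  decToMaybe (no _)  = nothing

-- Inequalities

≤-decide : ∀ {x y} {p : True (x ℚ.≤? y)} → x ≤ y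
≤-decide {p = p} = toWitness p

-- The standard form of an inequality proof below: the difference of the two sides is written as a
-- visibly nonnegative certificate `c`, and the remaining equation is left to the ring solver.
≤-from : ∀ {a b c} → 0ℚ ≤ c → b ≡ a + c → a ≤ b
≤-from {a} p refl = ≤-trans (≤-reflexive (≡.sym (ℚ.+-identityʳ a))) (ℚ.+-monoʳ-≤ a p)

0≤- : ∀ {a b} → a ≤ b → 0ℚ ≤ b - a
0≤- {a} {b} p = ≤-trans (≤-reflexive (≡.sym (ℚ.+-inverseʳ a))) (ℚ.+-monoˡ-≤ (- a) p)

0≤+ : ∀ {a b} → 0ℚ ≤ a → 0ℚ ≤ b → 0ℚ ≤ a + b
0≤+ = ℚ.+-mono-≤

0≤* : ∀ {a b} → 0ℚ ≤ a → 0ℚ ≤ b → 0ℚ ≤ a * b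
0≤* {a} {b} p q = ℚ.nonNegative⁻¹ (a * b)
  {{ℚ.nonNeg*nonNeg⇒nonNeg a {{nonNegative p}} b {{nonNegative q}}}}

0≤² : ∀ a → 0ℚ ≤ a * a
0≤² a with ℚ.≤-total 0ℚ a
... | inj₁ p = 0≤* p p
... | inj₂ p = ≤-trans (0≤* (0≤- p) (0≤- p)) (≤-reflexive (lemma a))
  where
  lemma : ∀ a → (0ℚ - a) * (0ℚ - a) ≡ a * a
  lemma = solve-∀ ℚ-ring

*-monoˡ : ∀ {a b} c → 0ℚ ≤ c → a ≤ b → c * a ≤ c * b
*-monoˡ c p = ℚ.*-monoˡ-≤-nonNeg c {{nonNegative p}}

*-mono : ∀ {a b c d} → 0ℚ ≤ a → 0ℚ ≤ d → a ≤ b → c ≤ d → a * c ≤ b * d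
*-mono {a} {b} {c} {d} 0≤a 0≤d p q =
  ≤-from (0≤+ (0≤* 0≤a (0≤- q)) (0≤* (0≤- p) 0≤d)) (lemma a b c d)
  where
  lemma : ∀ a b c d → b * d ≡ a * c + (a * (d - c) + (b - a) * d)
  lemma = solve-∀ ℚ-ring

-- The embedding ℕ→ℚ

toℚᵘ-ℕ→ℚ : ∀ k → toℚᵘ (ℕ→ℚ k) ℚᵘ.≃ mkℚᵘ (ℤ.+ k) 0
toℚᵘ-ℕ→ℚ k = ℚ.toℚᵘ-fromℚᵘ (mkℚᵘ (ℤ.+ k) 0)

ℕ→ℚ-+ : ∀ m n → ℕ→ℚ (m +ℕ n) ≡ ℕ→ℚ m + ℕ→ℚ n
ℕ→ℚ-+ m n = ℚ.toℚᵘ-injective (ℚᵘ.≃-trans (toℚᵘ-ℕ→ℚ (m +ℕ n)) (ℚᵘ.≃-trans (ℚᵘ.*≡* eq)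
  (ℚᵘ.≃-sym (ℚᵘ.≃-trans (ℚ.toℚᵘ-homo-+ (ℕ→ℚ m) (ℕ→ℚ n)) (ℚᵘ.+-cong (toℚᵘ-ℕ→ℚ m) (toℚᵘ-ℕ→ℚ n))))))
  where
  eq : (ℤ.+ (m +ℕ n)) ℤ.* (ℤ.+ 1) ≡ ((ℤ.+ m) ℤ.* (ℤ.+ 1) ℤ.+ (ℤ.+ n) ℤ.* (ℤ.+ 1)) ℤ.* (ℤ.+ 1)
  eq = cong (ℤ._* (ℤ.+ 1)) (≡.sym (cong₂ ℤ._+_ (ℤ.*-identityʳ (ℤ.+ m)) (ℤ.*-identityʳ (ℤ.+ n))))

ℕ→ℚ-* : ∀ m n → ℕ→ℚ (m *ℕ n) ≡ ℕ→ℚ m * ℕ→ℚ n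
ℕ→ℚ-* m n = ℚ.toℚᵘ-injective (ℚᵘ.≃-trans (toℚᵘ-ℕ→ℚ (m *ℕ n)) (ℚᵘ.≃-trans (ℚᵘ.*≡* eq)
  (ℚᵘ.≃-sym (ℚᵘ.≃-trans (ℚ.toℚᵘ-homo-* (ℕ→ℚ m) (ℕ→ℚ n)) (ℚᵘ.*-cong (toℚᵘ-ℕ→ℚ m) (toℚᵘ-ℕ→ℚ n))))))
  where
  eq : (ℤ.+ (m *ℕ n)) ℤ.* (ℤ.+ 1) ≡ ((ℤ.+ m) ℤ.* (ℤ.+ n)) ℤ.* (ℤ.+ 1)
  eq = cong (ℤ._* (ℤ.+ 1)) (ℤ.pos-* m n)

ℕ→ℚ-mono : ∀ {m n} → m ≤ℕ n → ℕ→ℚ m ≤ ℕ→ℚ n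
ℕ→ℚ-mono {m} {n} p = ℚ.toℚᵘ-cancel-≤
  (ℚᵘ.≤-respˡ-≃ (ℚᵘ.≃-sym (toℚᵘ-ℕ→ℚ m)) (ℚᵘ.≤-respʳ-≃ (ℚᵘ.≃-sym (toℚᵘ-ℕ→ℚ n))
    (ℚᵘ.*≤* (ℤ.*-monoʳ-≤-nonNeg (ℤ.+ 1) (ℤ.+≤+ p)))))

ℕ→ℚ-nonneg : ∀ n → 0ℚ ≤ ℕ→ℚ n
ℕ→ℚ-nonneg n = ℕ→ℚ-mono {0} {n} z≤n

-- Finite sums

sum-mono : ∀ {n} {f g : Fin n → ℚ} → (∀ i → f i ≤ g i) → sum f ≤ sum g
sum-mono {zero}  p = ≤-refl
sum-mono {suc n} p = ℚ.+-mono-≤ (p zero) (sum-mono (λ i → p (suc i)))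

sum-const : ∀ n c → sum {n} (λ _ → c) ≡ ℕ→ℚ n * c
sum-const zero    c = ≡.sym (ℚ.*-zeroˡ c)
sum-const (suc n) c = trans (cong (c +_) (sum-const n c))
  (trans (lemma c (ℕ→ℚ n)) (cong (_* c) (≡.sym (ℕ→ℚ-+ 1 n))))
  where
  lemma : ∀ c m → c + m * c ≡ (1 + m) * c
  lemma = solve-∀ ℚ-ring

sum-zero : ∀ n → sum {n} (λ _ → 0ℚ) ≡ 0ℚ
sum-zero n = trans (sum-const n 0ℚ) (ℚ.*-zeroʳ (ℕ→ℚ n))

sum-nonneg : ∀ {n} {f : Fin n → ℚ} → (∀ i → 0ℚ ≤ f i) → 0ℚ ≤ sum f
sum-nonneg {n} {f} p = subst (_≤ sum f) (sum-zero n) (sum-mono p)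

sum-linear : ∀ {n} α β (f g : Fin n → ℚ) → sum (λ i → α * f i + β * g i) ≡ α * sum f + β * sum g
sum-linear α β f g = trans (∑-distrib-+ (λ i → α * f i) (λ i → β * g i))
  (≡.sym (cong₂ _+_ (*-distribˡ-sum α f) (*-distribˡ-sum β g)))

-- Rounding

⟪_,_⟫ : ∀ {n} → (Fin n → Fin n → ℚ) → (Fin n → Fin n → ℚ) → ℚ
⟪ A , B ⟫ = sum λ u → sum λ v → A u v * B u v

⟪⟫-cong : ∀ {n} (A : Fin n → Fin n → ℚ) {B C : Fin n → Fin n → ℚ} →
          (∀ u v → B u v ≡ C u v) → ⟪ A , B ⟫ ≡ ⟪ A , C ⟫
⟪⟫-cong A p = sum-cong-≗ λ u → sum-cong-≗ λ v → cong (A u v *_) (p u v)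

⟪⟫-mono : ∀ {n} {A B C : Fin n → Fin n → ℚ} → (∀ u v → 0ℚ ≤ A u v) →
          (∀ u v → B u v ≤ C u v) → ⟪ A , B ⟫ ≤ ⟪ A , C ⟫
⟪⟫-mono {A = A} 0≤A p = sum-mono λ u → sum-mono λ v → *-monoˡ (A u v) (0≤A u v) (p u v)

⟪⟫-linear : ∀ {n} (A : Fin n → Fin n → ℚ) α β (B C : Fin n → Fin n → ℚ) →
            ⟪ A , (λ u v → α * B u v + β * C u v) ⟫ ≡ α * ⟪ A , B ⟫ + β * ⟪ A , C ⟫
⟪⟫-linear A α β B C = trans
  (sum-cong-≗ λ u → trans
    (sum-cong-≗ λ v → lemma α β (A u v) (B u v) (C u v))
    (sum-linear α β (λ v → A u v * B u v) (λ v → A u v * C u v)))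
  (sum-linear α β (λ u → sum λ v → A u v * B u v) (λ u → sum λ v → A u v * C u v))
  where
  lemma : ∀ α β a b c → a * (α * b + β * c) ≡ α * (a * b) + β * (a * c)
  lemma = solve-∀ ℚ-ring

∏ : ∀ {n} → ℚ → List (Fin n → ℚ) → Fin n → Fin n → ℚ
∏ σ []       u v = 1ℚ
∏ σ (a ∷ as) u v = (1 + σ * (a u * a v)) * ∏ σ as u v

-- With Z = R + iI, the two brackets are the real parts of Z_u times the conjugate of Z_v and of Z_u
-- Z_v. Averaging over the sign of a factor 1 ± ia multiplies the first by 1 + a_u a_v and the
-- second by 1 - a_u a_v; their difference is 2 I_u I_v.
expected : ∀ {n} → (Fin n → ℚ) → (Fin n → ℚ) → List (Fin n → ℚ) → Fin n → Fin n → ℚ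
expected R I as u v =
  (R u * R v + I u * I v) * ∏ 1ℚ as u v - (R u * R v - I u * I v) * ∏ (- 1ℚ) as u v

-- Conditional expectations: the state (R , I) is the product of the factors 1 ± i a(v)
-- chosen so far, and expected is twice the mean of I u * I v over the remaining random signs.
derandomise : ∀ {n} (A : Fin n → Fin n → ℚ) (as : List (Fin n → ℚ)) (R I : Fin n → ℚ) →
  ∃ λ (J : Fin n → ℚ) →
    (∀ v → J v * J v ≤ (R v * R v + I v * I v) * ∏ 1ℚ as v v) ×
    2 * ⟪ A , (λ u v → J u * J v) ⟫ ≤ ⟪ A , expected R I as ⟫
derandomise A [] R I = I ,
  (λ v → ≤-from (0≤² (R v)) (lemma₁ (R v) (I v))) ,
  ≤-reflexive (trans (lemma₃ ⟪ A , (λ u v → I u * I v) ⟫)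
    (trans (≡.sym (⟪⟫-linear A 1 1 (λ u v → I u * I v) (λ u v → I u * I v)))
      (⟪⟫-cong A λ u v → lemma₂ (R u * R v) (I u * I v))))
  where
  lemma₁ : ∀ r i → (r * r + i * i) * 1ℚ ≡ i * i + r * r
  lemma₁ = solve-∀ ℚ-ring
  lemma₂ : ∀ r i → 1 * i + 1 * i ≡ (r + i) * 1ℚ - (r - i) * 1ℚ
  lemma₂ = solve-∀ ℚ-ring
  lemma₃ : ∀ i → 2 * i ≡ 1 * i + 1 * i
  lemma₃ = solve-∀ ℚ-ring
derandomise {n} A (a ∷ as) R I = choose (ℚ.≤-total (value 1ℚ) (value (- 1ℚ)))
  where
  R′ I′ : ℚ → Fin n → ℚ
  R′ g v = R v - g * (a v * I v)
  I′ g v = I v + g * (a v * R v)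

  value : ℚ → ℚ
  value g = ⟪ A , expected (R′ g) (I′ g) as ⟫

  total : ℚ
  total = ⟪ A , expected R I (a ∷ as) ⟫

  -- The terms odd in the sign cancel between the two branches. The coefficients 1 fit the shape of
  -- `⟪⟫-linear`.
  pointwise : ∀ r r′ i i′ x x′ P M →
    1 * (((r - 1ℚ * (x * i)) * (r′ - 1ℚ * (x′ * i′)) + (i + 1ℚ * (x * r)) * (i′ + 1ℚ * (x′ * r′))) * P
       - ((r - 1ℚ * (x * i)) * (r′ - 1ℚ * (x′ * i′)) - (i + 1ℚ * (x * r)) * (i′ + 1ℚ * (x′ * r′))) * M)
    + 1 * (((r - (- 1ℚ) * (x * i)) * (r′ - (- 1ℚ) * (x′ * i′)) + (i + (- 1ℚ) * (x * r)) * (i′ + (- 1ℚ) * (x′ * r′))) * P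
       - ((r - (- 1ℚ) * (x * i)) * (r′ - (- 1ℚ) * (x′ * i′)) - (i + (- 1ℚ) * (x * r)) * (i′ + (- 1ℚ) * (x′ * r′))) * M)
    ≡ 1 * ((r * r′ + i * i′) * ((1 + 1ℚ * (x * x′)) * P) - (r * r′ - i * i′) * ((1 + (- 1ℚ) * (x * x′)) * M))
    + 1 * ((r * r′ + i * i′) * ((1 + 1ℚ * (x * x′)) * P) - (r * r′ - i * i′) * ((1 + (- 1ℚ) * (x * x′)) * M))
  pointwise = solve-∀ ℚ-ring

  branch : ℚ → Fin n → Fin n → ℚ
  branch g = expected (R′ g) (I′ g) as

  average : 1 * value 1ℚ + 1 * value (- 1ℚ) ≡ 1 * total + 1 * total
  average = trans (≡.sym (⟪⟫-linear A 1 1 (branch 1ℚ) (branch (- 1ℚ))))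
    (trans (⟪⟫-cong A λ u v → pointwise (R u) (R v) (I u) (I v) (a u) (a v) (∏ 1ℚ as u v) (∏ (- 1ℚ) as u v))
    (⟪⟫-linear A 1 1 (expected R I (a ∷ as)) (expected R I (a ∷ as))))

  -- The modulus of 1 + igx depends on g² only, so the bound on J is the same in both branches.
  norm : ∀ g r i x P →
    ((r - g * (x * i)) * (r - g * (x * i)) + (i + g * (x * r)) * (i + g * (x * r))) * P
    ≡ (r * r + i * i) * ((1 + g * g * (x * x)) * P)
  norm = solve-∀ ℚ-ring

  smaller : ∀ x y z → 1 * x + 1 * y ≡ 1 * z + 1 * z → x ≤ y → x ≤ z
  smaller x y z e p = ≤-from (0≤* {½} ≤-decide (0≤- p))
    (trans (half z) (trans (cong (½ *_) (≡.sym e)) (rearrange x y)))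
    where
    half : ∀ z → z ≡ ½ * (1 * z + 1 * z)
    half = solve-∀ ℚ-ring
    rearrange : ∀ x y → ½ * (1 * x + 1 * y) ≡ x + ½ * (y - x)
    rearrange = solve-∀ ℚ-ring

  choose : (value 1ℚ ≤ value (- 1ℚ)) ⊎ (value (- 1ℚ) ≤ value 1ℚ) → _
  choose (inj₁ p) with derandomise A as (R′ 1ℚ) (I′ 1ℚ)
  ... | J , bound , le = J ,
    (λ v → ≤-trans (bound v) (≤-reflexive (norm 1ℚ (R v) (I v) (a v) (∏ 1ℚ as v v)))) ,
    ≤-trans le (smaller (value 1ℚ) (value (- 1ℚ)) total average p)
  choose (inj₂ p) with derandomise A as (R′ (- 1ℚ)) (I′ (- 1ℚ))
  ... | J , bound , le = J ,
    (λ v → ≤-trans (bound v) (≤-reflexive (norm (- 1ℚ) (R v) (I v) (a v) (∏ 1ℚ as v v)))) ,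
    ≤-trans le (smaller (value (- 1ℚ)) (value 1ℚ) total
      (trans (ℚ.+-comm (1 * value (- 1ℚ)) (1 * value 1ℚ)) average) p)

-- Products close to their first-order expansion

gram : ∀ {n} → List (Fin n → ℚ) → Fin n → Fin n → ℚ
gram []       u v = 0ℚ
gram (a ∷ as) u v = a u * a v + gram as u v

-- Encodes |P - (1 + S)| ≤ b² and |S| ≤ b without absolute values, so that each conjunct can be
-- multiplied directly into a certificate.
Near : ℚ → ℚ → ℚ → Set
Near P S b = 1 + S - b * b ≤ P × P ≤ 1 + S + b * b × 0ℚ ≤ b + S × 0ℚ ≤ b - S

halves : ∀ {b S} → 0ℚ ≤ b + S → 0ℚ ≤ b - S → 0ℚ ≤ b
halves {b} {S} p q = ≤-trans (0≤* {½} ≤-decide (0≤+ p q)) (≤-reflexive (lemma b S))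
  where
  lemma : ∀ b S → ½ * ((b + S) + (b - S)) ≡ b
  lemma = solve-∀ ℚ-ring

-- The new error is (1 + t)(P - 1 - S) + tS, at most (1 + β)b² + βb in absolute value. This is at
-- most (β + b)² since b ≤ 1. The bound |tS| ≤ βb appears as half the sum of products such as (β +
-- t)(b + S) and (β - t)(b - S).
Near-step : ∀ {P S b t β} → 0ℚ ≤ β + t → 0ℚ ≤ β - t → β + b ≤ 1ℚ →
            Near P S b → Near ((1 + t) * P) (t + S) (β + b)
Near-step {P} {S} {b} {t} {β} β+t β-t β+b≤1 (lo , hi , b+S , b-S) =
  ≤-from (0≤+ (0≤+ (0≤+ (0≤* 0≤1+t (0≤- lo)) (0≤* {½} ≤-decide (0≤+ (0≤* β+t b+S) (0≤* β-t b-S)))) slack) (0≤² β))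
    (lower P S b t β) ,
  ≤-from (0≤+ (0≤+ (0≤+ (0≤* 0≤1+t (0≤- hi)) (0≤* {½} ≤-decide (0≤+ (0≤* β-t b+S) (0≤* β+t b-S)))) slack) (0≤² β))
    (upper P S b t β) ,
  ≤-trans (0≤+ β+t b+S) (≤-reflexive (sum₊ S b t β)) ,
  ≤-trans (0≤+ β-t b-S) (≤-reflexive (sum₋ S b t β))
  where
  0≤b : 0ℚ ≤ b
  0≤b = halves b+S b-S
  0≤β : 0ℚ ≤ β
  0≤β = halves β+t β-t
  0≤1+t : 0ℚ ≤ 1 + t
  0≤1+t = ≤-trans (0≤+ (0≤+ β+t 0≤b) (0≤- β+b≤1)) (≤-reflexive (lemma b t β))
    where
    lemma : ∀ b t β → β + t + b + (1ℚ - (β + b)) ≡ 1 + t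
    lemma = solve-∀ ℚ-ring
  slack : 0ℚ ≤ b * ((β - t) * b + β * (1ℚ - (β + b) + β))
  slack = 0≤* 0≤b (0≤+ (0≤* β-t 0≤b) (0≤* 0≤β (0≤+ (0≤- β+b≤1) 0≤β)))
  lower : ∀ P S b t β → (1 + t) * P ≡ 1 + (t + S) - (β + b) * (β + b) +
    ((1 + t) * (P - (1 + S - b * b)) + ½ * ((β + t) * (b + S) + (β - t) * (b - S))
      + b * ((β - t) * b + β * (1ℚ - (β + b) + β)) + β * β)
  lower = solve-∀ ℚ-ring
  upper : ∀ P S b t β → 1 + (t + S) + (β + b) * (β + b) ≡ (1 + t) * P +
    ((1 + t) * ((1 + S + b * b) - P) + ½ * ((β - t) * (b + S) + (β + t) * (b - S))
      + b * ((β - t) * b + β * (1ℚ - (β + b) + β)) + β * β)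
  upper = solve-∀ ℚ-ring
  sum₊ : ∀ S b t β → β + t + (b + S) ≡ β + b + (t + S)
  sum₊ = solve-∀ ℚ-ring
  sum₋ : ∀ S b t β → β - t + (b - S) ≡ β + b - (t + S)
  sum₋ = solve-∀ ℚ-ring

-- Each factor has |σxy| ≤ ½(x² + y²), and these bounds add up to half the sum of the two squared
-- norms. The error therefore depends on the norms alone and not on the size of single coordinates.
∏-near : ∀ {n} σ (as : List (Fin n → ℚ)) (u v : Fin n) → σ * σ ≤ 1ℚ →
         ½ * (gram as u u + gram as v v) ≤ 1ℚ →
         Near (∏ σ as u v) (σ * gram as u v) (½ * (gram as u u + gram as v v))
∏-near σ [] u v _ _ = subst₂ (Near 1ℚ) (≡.sym (ℚ.*-zeroʳ σ)) refl
  (≤-decide , ≤-decide , ≤-decide , ≤-decide)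
∏-near σ (a ∷ as) u v σ²≤1 b≤1 =
  subst₂ (Near _) (S-eq σ (a u) (a v) (gram as u v)) (b-eq (a u) (a v) (gram as u u) (gram as v v))
    (Near-step {∏ σ as u v} {σ * gram as u v} {½ * (gram as u u + gram as v v)} {σ * (x * y)}
      {½ * (x * x + y * y)} β+t β-t b≤1′ (∏-near σ as u v σ²≤1 rest≤1))
  where
  x = a u
  y = a v
  S-eq : ∀ σ x y g → σ * (x * y) + σ * g ≡ σ * (x * y + g)
  S-eq = solve-∀ ℚ-ring
  b-eq : ∀ x y g h → ½ * (x * x + y * y) + ½ * (g + h) ≡ ½ * ((x * x + g) + (y * y + h))
  b-eq = solve-∀ ℚ-ring
  b≤1′ : ½ * (x * x + y * y) + ½ * (gram as u u + gram as v v) ≤ 1ℚ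
  b≤1′ = ≤-trans (≤-reflexive (b-eq x y (gram as u u) (gram as v v))) b≤1
  rest≤1 : ½ * (gram as u u + gram as v v) ≤ 1ℚ
  rest≤1 = ≤-trans (≤-from (0≤* {½} ≤-decide (0≤+ (0≤² x) (0≤² y))) (ℚ.+-comm (½ * (x * x + y * y)) _)) b≤1′
  β+t : 0ℚ ≤ ½ * (x * x + y * y) + σ * (x * y)
  β+t = ≤-trans (0≤* {½} ≤-decide (0≤+ (0≤² (x + σ * y)) (0≤* (0≤- σ²≤1) (0≤² y)))) (≤-reflexive (lemma σ x y))
    where
    lemma : ∀ σ x y → ½ * ((x + σ * y) * (x + σ * y) + (1ℚ - σ * σ) * (y * y)) ≡ ½ * (x * x + y * y) + σ * (x * y)
    lemma = solve-∀ ℚ-ring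
  β-t : 0ℚ ≤ ½ * (x * x + y * y) - σ * (x * y)
  β-t = ≤-trans (0≤* {½} ≤-decide (0≤+ (0≤² (x - σ * y)) (0≤* (0≤- σ²≤1) (0≤² y)))) (≤-reflexive (lemma σ x y))
    where
    lemma : ∀ σ x y → ½ * ((x - σ * y) * (x - σ * y) + (1ℚ - σ * σ) * (y * y)) ≡ ½ * (x * x + y * y) - σ * (x * y)
    lemma = solve-∀ ℚ-ring

-- Powers and Bernoulli's inequality

^-nonneg : ∀ {x} n → 0ℚ ≤ x → 0ℚ ≤ x ^ n
^-nonneg zero    p = ≤-decide
^-nonneg (suc n) p = 0≤* p (^-nonneg n p)

^-mono : ∀ {x y} n → 0ℚ ≤ x → x ≤ y → x ^ n ≤ y ^ n
^-mono zero    0≤x p = ≤-refl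
^-mono (suc n) 0≤x p = *-mono 0≤x (^-nonneg n (≤-trans 0≤x p)) p (^-mono n 0≤x p)

bernoulli : ∀ {x} n → 0ℚ ≤ 1 + x → 1 + ℕ→ℚ n * x ≤ (1 + x) ^ n
bernoulli {x} zero    p = ≤-reflexive (trans (cong (1 +_) (ℚ.*-zeroˡ x)) (ℚ.+-identityʳ 1))
bernoulli {x} (suc n) p = ≤-trans
  (≤-from (0≤* (ℕ→ℚ-nonneg n) (0≤² x)) (trans (lemma x (ℕ→ℚ n))
     (cong (λ m → 1 + m * x + ℕ→ℚ n * (x * x)) (≡.sym (ℕ→ℚ-+ 1 n)))))
  (*-monoˡ (1 + x) p (bernoulli n p))
  where
  lemma : ∀ x m → (1 + x) * (1 + m * x) ≡ 1 + (1 + m) * x + m * (x * x)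
  lemma = solve-∀ ℚ-ring

^-≤1 : ∀ {x} n → 0ℚ ≤ x → x ≤ 1ℚ → x ^ n ≤ 1ℚ
^-≤1 zero    p q = ≤-refl
^-≤1 (suc n) p q = *-mono p ≤-decide q (^-≤1 n p q)

^-distrib-* : ∀ x y n → (x * y) ^ n ≡ x ^ n * y ^ n
^-distrib-* x y zero    = refl
^-distrib-* x y (suc n) = trans (cong (x * y *_) (^-distrib-* x y n)) (lemma x y (x ^ n) (y ^ n))
  where
  lemma : ∀ x y a b → x * y * (a * b) ≡ x * a * (y * b)
  lemma = solve-∀ ℚ-ring

copies : ∀ {n} → ℕ → List (Fin n → ℚ) → List (Fin n → ℚ)
copies zero    as = []
copies (suc N) as = as ++ copies N as

∏-++ : ∀ {n} σ (as bs : List (Fin n → ℚ)) u v → ∏ σ (as ++ bs) u v ≡ ∏ σ as u v * ∏ σ bs u v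
∏-++ σ []       bs u v = ≡.sym (ℚ.*-identityˡ _)
∏-++ σ (a ∷ as) bs u v = trans (cong ((1 + σ * (a u * a v)) *_) (∏-++ σ as bs u v)) (≡.sym (ℚ.*-assoc (1 + σ * (a u * a v)) (∏ σ as u v) (∏ σ bs u v)))

∏-copies : ∀ {n} σ N (as : List (Fin n → ℚ)) u v → ∏ σ (copies N as) u v ≡ ∏ σ as u v ^ N
∏-copies σ zero    as u v = refl
∏-copies σ (suc N) as u v = trans (∏-++ σ as (copies N as) u v) (cong (∏ σ as u v *_) (∏-copies σ N as u v))

module _ (N : ℕ) {η w : ℚ} (Nη≡1 : ℕ→ℚ N * η ≡ 1ℚ) (0≤η : 0ℚ ≤ η) (η≤1 : η ≤ 1ℚ)
         (0≤½+w : 0ℚ ≤ ½ + w) (0≤½-w : 0ℚ ≤ ½ - w) where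

  private
    0≤1+ηw : 0ℚ ≤ 1 + η * w
    0≤1+ηw = ≤-trans (0≤+ (0≤+ (0≤* 0≤η 0≤½+w) (0≤* {½} ≤-decide (0≤- η≤1))) (≤-decide {0ℚ} {½})) (≤-reflexive (lemma η w))
      where
      lemma : ∀ η w → η * (½ + w) + ½ * (1ℚ - η) + ½ ≡ 1 + η * w
      lemma = solve-∀ ℚ-ring

    0≤1-ηw : 0ℚ ≤ 1 + (- (η * w))
    0≤1-ηw = ≤-trans (0≤+ (0≤+ (0≤* 0≤η 0≤½-w) (0≤* {½} ≤-decide (0≤- η≤1))) (≤-decide {0ℚ} {½})) (≤-reflexive (lemma η w))
      where
      lemma : ∀ η w → η * (½ - w) + ½ * (1ℚ - η) + ½ ≡ 1 + (- (η * w))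
      lemma = solve-∀ ℚ-ring

    bernoulli₋ : 1 - w ≤ (1 + (- (η * w))) ^ N
    bernoulli₋ = ≤-trans (≤-reflexive (trans (cong (λ z → 1 - z) (≡.sym (trans (cong (_* w) Nη≡1) (ℚ.*-identityˡ w)))) (lemma (ℕ→ℚ N) η w)))
                         (bernoulli N 0≤1-ηw)
      where
      lemma : ∀ N η w → 1 - (N * η) * w ≡ 1 + N * (- (η * w))
      lemma = solve-∀ ℚ-ring

  ^-lower : ∀ {x} → 1 + (- (η * w)) ≤ x → 1 - w ≤ x ^ N
  ^-lower p = ≤-trans bernoulli₋ (^-mono N 0≤1-ηw p)

  -- (1 + ηw)ᴺ (1 - ηw)ᴺ ≤ 1 turns the lower bound of Bernoulli's inequality into an upper bound.
  ^-upper : ∀ {x} → 0ℚ ≤ x → x ≤ 1 + η * w → x ^ N ≤ 1 + w + 2 * (w * w)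
  ^-upper {x} 0≤x p = ≤-trans (^-mono N 0≤x p) (cancel (≤-trans product≤1 1≤product))
    where
    product≤1 : (1 + η * w) ^ N * (1 - w) ≤ 1ℚ
    product≤1 = ≤-trans (*-monoˡ ((1 + η * w) ^ N) (^-nonneg N 0≤1+ηw) bernoulli₋)
      (≤-trans (≤-reflexive (≡.sym (^-distrib-* (1 + η * w) (1 + (- (η * w))) N)))
        (^-≤1 N (0≤* 0≤1+ηw 0≤1-ηw) (≤-from (0≤² (η * w)) (lemma η w))))
      where
      lemma : ∀ η w → 1ℚ ≡ (1 + η * w) * (1 + (- (η * w))) + η * w * (η * w)
      lemma = solve-∀ ℚ-ring

    1≤product : 1ℚ ≤ (1 + w + 2 * (w * w)) * (1 - w)
    1≤product = ≤-from (0≤* (0≤² w) (0≤+ 0≤½-w 0≤½-w)) (lemma w)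
      where
      lemma : ∀ w → (1 + w + 2 * (w * w)) * (1 - w) ≡ 1ℚ + w * w * ((½ - w) + (½ - w))
      lemma = solve-∀ ℚ-ring

    cancel : ∀ {y z} → y * (1 - w) ≤ z * (1 - w) → y ≤ z
    cancel = ℚ.*-cancelʳ-≤-pos (1 - w) {{positive (ℚ.<-≤-trans (ℚ.positive⁻¹ ½) (≤-from 0≤½-w (lemma w)))}}
      where
      lemma : ∀ w → 1 - w ≡ ½ + (½ - w)
      lemma = solve-∀ ℚ-ring

gram-tabulate : ∀ {m n} κ (X : Fin m → Fin n → ℚ) u v →
  gram (tabulate λ j i → κ * X j i) u v ≡ κ * κ * sum (λ j → X j u * X j v)
gram-tabulate {zero}  κ X u v = ≡.sym (ℚ.*-zeroʳ (κ * κ))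
gram-tabulate {suc m} κ X u v = trans
  (cong (κ * X zero u * (κ * X zero v) +_) (gram-tabulate κ (λ j → X (suc j)) u v))
  (lemma κ (X zero u) (X zero v) (sum λ j → X (suc j) u * X (suc j) v))
  where
  lemma : ∀ κ x y s → κ * x * (κ * y) + κ * κ * s ≡ κ * κ * (x * y + s)
  lemma = solve-∀ ℚ-ring

-- Each vector is split into k² copies scaled by κ = 1/k, so that the products over the
-- coordinates are close to exp(± inner product) whatever the individual coordinates are.
module _ {m n} (A : Fin n → Fin n → ℚ) (0≤A : ∀ u v → 0ℚ ≤ A u v) (X : Fin m → Fin n → ℚ)
         (k : ℕ) (κ : ℚ) (kκ≡1 : ℕ→ℚ k * κ ≡ 1ℚ) (0≤κ : 0ℚ ≤ κ) (κ≤½ : κ ≤ ½)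
         (norm≤¼ : ∀ v → sum (λ j → X j v * X j v) ≤ ½ * ½) where

  private
    N : ℕ
    N = k *ℕ k

    η : ℚ
    η = κ * κ

    G : Fin n → Fin n → ℚ
    G u v = sum λ j → X j u * X j v

    base : List (Fin n → ℚ)
    base = tabulate λ j i → κ * X j i

    Nη≡1 : ℕ→ℚ N * η ≡ 1ℚ
    Nη≡1 = trans (cong (_* η) (ℕ→ℚ-* k k)) (trans (lemma (ℕ→ℚ k) κ) (cong₂ _*_ kκ≡1 kκ≡1))
      where
      lemma : ∀ k κ → k * k * (κ * κ) ≡ k * κ * (k * κ)
      lemma = solve-∀ ℚ-ring

    0≤η : 0ℚ ≤ η
    0≤η = 0≤² κ

    η≤¼ : η ≤ ½ * ½
    η≤¼ = *-mono 0≤κ ≤-decide κ≤½ κ≤½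

    η≤1 : η ≤ 1ℚ
    η≤1 = ≤-trans η≤¼ ≤-decide

    module _ (u v : Fin n) where
      -- One block of scaled vectors has product within b² ≤ η² of 1 ± ηG. Enlarging G to `w` = G +
      -- η hides this error, because 1 + ηG + η² = 1 + ηw.
      w b : ℚ
      w = G u v + η
      b = ½ * (η * G u u + η * G v v)

      b≤η/4 : b ≤ ½ * ½ * η
      b≤η/4 = ≤-from (0≤* {½} ≤-decide (0≤* 0≤η (0≤+ (0≤- (norm≤¼ u)) (0≤- (norm≤¼ v))))) (lemma η (G u u) (G v v))
        where
        lemma : ∀ η g h → ½ * ½ * η ≡ ½ * (η * g + η * h) + ½ * (η * ((½ * ½ - g) + (½ * ½ - h)))
        lemma = solve-∀ ℚ-ring

      b≤¼ : b ≤ ½ * ½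
      b≤¼ = ≤-trans b≤η/4 (≤-from (0≤* {½ * ½} ≤-decide (0≤- η≤1)) (lemma η))
        where
        lemma : ∀ η → ½ * ½ ≡ ½ * ½ * η + ½ * ½ * (1ℚ - η)
        lemma = solve-∀ ℚ-ring

      near : ∀ σ → σ * σ ≤ 1ℚ → Near (∏ σ base u v) (σ * (η * G u v)) b
      near σ σ²≤1 = subst₂ (Near (∏ σ base u v)) (cong (σ *_) (gram-tabulate κ X u v)) b-eq
        (∏-near σ base u v σ²≤1 (subst (_≤ 1ℚ) (≡.sym b-eq) (≤-trans b≤¼ ≤-decide)))
        where
        b-eq : ½ * (gram base u u + gram base v v) ≡ b
        b-eq = cong (½ *_) (cong₂ _+_ (gram-tabulate κ X u u) (gram-tabulate κ X v v))

      0≤b+S : 0ℚ ≤ b + 1ℚ * (η * G u v)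
      0≤b+S = proj₁ (proj₂ (proj₂ (near 1ℚ ≤-decide)))

      0≤b-S : 0ℚ ≤ b - 1ℚ * (η * G u v)
      0≤b-S = proj₂ (proj₂ (proj₂ (near 1ℚ ≤-decide)))

      0≤b : 0ℚ ≤ b
      0≤b = halves {b} {1ℚ * (η * G u v)} 0≤b+S 0≤b-S

      b²≤η² : b * b ≤ η * η
      b²≤η² = *-mono 0≤b 0≤η b≤η b≤η
        where
        lemma : ∀ η → η ≡ ½ * ½ * η + (½ + ½ * ½) * η
        lemma = solve-∀ ℚ-ring
        b≤η : b ≤ η
        b≤η = ≤-trans b≤η/4 (≤-from (0≤* {½ + ½ * ½} ≤-decide 0≤η) (lemma η))

      cancel-η : ∀ {x} → 0ℚ ≤ η * x → 0ℚ ≤ x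
      cancel-η {x} p = ≤-trans (0≤* (ℕ→ℚ-nonneg N) p)
        (≤-reflexive (trans (≡.sym (ℚ.*-assoc (ℕ→ℚ N) η x)) (trans (cong (_* x) Nη≡1) (ℚ.*-identityˡ x))))

      -- No separate Cauchy-Schwarz inequality is needed: `Near` already contains η|G| ≤ b, and b ≤
      -- η/4.
      0≤¼+G : 0ℚ ≤ ½ * ½ + G u v
      0≤¼+G = cancel-η (≤-trans (0≤+ 0≤b+S (0≤- b≤η/4)) (≤-reflexive (lemma η (G u v) b)))
        where
        lemma : ∀ η g b → b + 1ℚ * (η * g) + (½ * ½ * η - b) ≡ η * (½ * ½ + g)
        lemma = solve-∀ ℚ-ring

      0≤¼-G : 0ℚ ≤ ½ * ½ - G u v
      0≤¼-G = cancel-η (≤-trans (0≤+ 0≤b-S (0≤- b≤η/4)) (≤-reflexive (lemma η (G u v) b)))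
        where
        lemma : ∀ η g b → b - 1ℚ * (η * g) + (½ * ½ * η - b) ≡ η * (½ * ½ - g)
        lemma = solve-∀ ℚ-ring

      0≤½+w : 0ℚ ≤ ½ + w
      0≤½+w = ≤-trans (0≤+ (0≤+ 0≤¼+G 0≤η) (≤-decide {0ℚ} {½ * ½})) (≤-reflexive (lemma η (G u v)))
        where
        lemma : ∀ η g → ½ * ½ + g + η + ½ * ½ ≡ ½ + (g + η)
        lemma = solve-∀ ℚ-ring

      0≤½-w : 0ℚ ≤ ½ - w
      0≤½-w = ≤-trans (0≤+ 0≤¼-G (0≤- η≤¼)) (≤-reflexive (lemma η (G u v)))
        where
        lemma : ∀ η g → ½ * ½ - g + (½ * ½ - η) ≡ ½ - (g + η)
        lemma = solve-∀ ℚ-ring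

      0≤∏₊ : 0ℚ ≤ ∏ 1ℚ base u v
      0≤∏₊ = ≤-trans (≤-trans (0≤+ (0≤+ 0≤b+S (0≤+ (0≤- b≤½) (0≤- b≤½))) (0≤* 0≤b (0≤+ (0≤- b≤½) (≤-decide {0ℚ} {½}))))
                              (≤-reflexive (lemma b (1ℚ * (η * G u v)))))
                     (proj₁ (near 1ℚ ≤-decide))
        where
        b≤½ : b ≤ ½
        b≤½ = ≤-trans b≤¼ ≤-decide
        lemma : ∀ b S → b + S + (½ - b + (½ - b)) + b * (½ - b + ½) ≡ 1 + S - b * b
        lemma = solve-∀ ℚ-ring

      power₊ : ∏ 1ℚ (copies N base) u v ≤ 1 + w + 2 * (w * w)
      power₊ = subst (_≤ 1 + w + 2 * (w * w)) (≡.sym (∏-copies 1ℚ N base u v))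
        (^-upper N Nη≡1 0≤η η≤1 0≤½+w 0≤½-w 0≤∏₊
          (≤-trans (proj₁ (proj₂ (near 1ℚ ≤-decide))) (≤-from (0≤- b²≤η²) (lemma η (G u v) b))))
        where
        lemma : ∀ η g b → 1 + η * (g + η) ≡ 1 + 1ℚ * (η * g) + b * b + (η * η - b * b)
        lemma = solve-∀ ℚ-ring

      power₋ : 1 - w ≤ ∏ (- 1ℚ) (copies N base) u v
      power₋ = subst (1 - w ≤_) (≡.sym (∏-copies (- 1ℚ) N base u v))
        (^-lower N Nη≡1 0≤η η≤1 0≤½+w 0≤½-w
          (≤-trans (≤-from (0≤- b²≤η²) (lemma η (G u v) b)) (proj₁ (near (- 1ℚ) ≤-decide))))
        where
        lemma : ∀ η g b → 1 + (- 1ℚ) * (η * g) - b * b ≡ 1 + (- (η * (g + η))) + (η * η - b * b)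
        lemma = solve-∀ ℚ-ring

    bound : Fin n → Fin n → ℚ
    bound u v = G u v + 2 * (G u v * G u v) + 2 * η

    start : Fin n → ℚ
    start _ = 1ℚ

    -- One-sided bounds suffice because A is nonnegative. Both `power₊` and `power₋` are only
    -- first-order sharp, which produces the term in G². The summand `0 * 0ℚ` pads the right side to
    -- the shape of `⟪⟫-linear`.
    expected≤ : ∀ u v → expected start (λ _ → 0ℚ) (copies N base) u v ≤ 2 * bound u v + 0 * 0ℚ
    expected≤ u v = ≤-from
      (0≤+ (0≤+ (0≤- (power₊ u v)) (0≤- (power₋ u v)))
           (0≤* {1 + 1} ≤-decide (0≤+ (0≤² (G u v - η)) (0≤* 0≤η (0≤+ (0≤- η≤¼) (0≤+ (0≤- η≤¼) (≤-decide {0ℚ} {½})))))))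
      (lemma (∏ 1ℚ (copies N base) u v) (∏ (- 1ℚ) (copies N base) u v) (G u v) η)
      where
      lemma : ∀ P M g η → 2 * (g + 2 * (g * g) + 2 * η) + 0 * 0ℚ ≡
        (1ℚ * 1ℚ + 0ℚ * 0ℚ) * P - (1ℚ * 1ℚ - 0ℚ * 0ℚ) * M +
        ((1 + (g + η) + 2 * ((g + η) * (g + η)) - P) + (M - (1 - (g + η)))
          + (1 + 1) * ((g - η) * (g - η) + η * ((½ * ½ - η) + ((½ * ½ - η) + ½))))
      lemma = solve-∀ ℚ-ring

    outcome = derandomise A (copies N base) start (λ _ → 0ℚ)

  rounding : ∃ λ (J : Fin n → ℚ) → (∀ v → J v * J v ≤ 2) ×
    ⟪ A , (λ u v → J u * J v) ⟫ ≤
    ⟪ A , (λ u v → let g = sum (λ j → X j u * X j v) in g + 2 * (g * g) + 2 * (κ * κ)) ⟫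
  rounding = proj₁ outcome ,
    (λ v → ≤-trans (proj₁ (proj₂ outcome) v) (≤-trans (≤-reflexive (unit (∏ 1ℚ (copies N base) v v)))
      (≤-trans (power₊ v v) (small (w v v) (0≤½+w v v) (0≤½-w v v))))) ,
    ℚ.*-cancelˡ-≤-pos 2 (≤-trans (proj₂ (proj₂ outcome)) (≤-trans (⟪⟫-mono 0≤A expected≤)
      (≤-reflexive (trans (⟪⟫-linear A 2 0 bound (λ _ _ → 0ℚ)) (drop ⟪ A , bound ⟫ ⟪ A , (λ _ _ → 0ℚ) ⟫)))))
    where
    unit : ∀ P → (1ℚ * 1ℚ + 0ℚ * 0ℚ) * P ≡ P
    unit = solve-∀ ℚ-ring
    drop : ∀ t z → 2 * t + 0 * z ≡ 2 * t
    drop = solve-∀ ℚ-ring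
    small : ∀ w → 0ℚ ≤ ½ + w → 0ℚ ≤ ½ - w → 1 + w + 2 * (w * w) ≤ 2
    small w p q = ≤-from (0≤* (0≤+ q q) (0≤+ p (≤-decide {0ℚ} {½}))) (lemma w)
      where
      lemma : ∀ w → 2 ≡ 1 + w + 2 * (w * w) + (½ - w + (½ - w)) * (½ + w + ½)
      lemma = solve-∀ ℚ-ring

-- Doubly stochastic symmetric matrices

⟨_,_⟩ : ∀ {n} → (Fin n → ℚ) → (Fin n → ℚ) → ℚ
⟨ x , y ⟩ = sum λ u → x u * y u

⟨⟩-cong : ∀ {n} {x x′ y y′ : Fin n → ℚ} → (∀ u → x u ≡ x′ u) → (∀ u → y u ≡ y′ u) → ⟨ x , y ⟩ ≡ ⟨ x′ , y′ ⟩
⟨⟩-cong p q = sum-cong-≗ λ u → cong₂ _*_ (p u) (q u)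

⟨⟩-congʳ : ∀ {n} (x : Fin n → ℚ) {y y′ : Fin n → ℚ} → (∀ u → y u ≡ y′ u) → ⟨ x , y ⟩ ≡ ⟨ x , y′ ⟩
⟨⟩-congʳ x p = sum-cong-≗ λ u → cong (x u *_) (p u)

⟨⟩-comm : ∀ {n} (x y : Fin n → ℚ) → ⟨ x , y ⟩ ≡ ⟨ y , x ⟩
⟨⟩-comm x y = sum-cong-≗ λ u → ℚ.*-comm (x u) (y u)

⟨⟩-nonneg : ∀ {n} (x : Fin n → ℚ) → 0ℚ ≤ ⟨ x , x ⟩
⟨⟩-nonneg x = sum-nonneg λ u → 0≤² (x u)

module Stochastic {n} (K : Fin n → Fin n → ℚ) (K-sym : ∀ u v → K u v ≡ K v u)
                  (0≤K : ∀ u v → 0ℚ ≤ K u v) (row-sum : ∀ u → sum (K u) ≡ 1ℚ) where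

  T : (Fin n → ℚ) → Fin n → ℚ
  T z u = sum λ w → K u w * z w

  shift : ℚ → (Fin n → ℚ) → Fin n → ℚ
  shift c z u = z u - c * T z u

  T-cong : ∀ {x y} → (∀ u → x u ≡ y u) → ∀ u → T x u ≡ T y u
  T-cong p u = sum-cong-≗ λ w → cong (K u w *_) (p w)

  shift-cong : ∀ c {x y} → (∀ u → x u ≡ y u) → ∀ u → shift c x u ≡ shift c y u
  shift-cong c p u = cong₂ (λ a b → a - c * b) (p u) (T-cong p u)

  T-shift : ∀ c z u → T (shift c z) u ≡ shift c (T z) u
  T-shift c z u = trans (sum-cong-≗ λ w → expand (K u w) (z w) c (T z w))
    (trans (sum-linear 1 (- c) (λ w → K u w * z w) (λ w → K u w * T z w))
      (collect (T z u) c (T (T z) u)))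
    where
    expand : ∀ k z c t → k * (z - c * t) ≡ 1 * (k * z) + (- c) * (k * t)
    expand = solve-∀ ℚ-ring
    collect : ∀ a c b → 1 * a + (- c) * b ≡ a - c * b
    collect = solve-∀ ℚ-ring

  T-shift² : ∀ c z u → T (shift c (shift c z)) u ≡ shift c (shift c (T z)) u
  T-shift² c z u = trans (T-shift c (shift c z) u) (shift-cong c (T-shift c z) u)

  shift-comm : ∀ c e z u → shift c (shift e z) u ≡ shift e (shift c z) u
  shift-comm c e z u = trans (cong (λ t → shift e z u - c * t) (T-shift e z u))
    (trans (lemma c e (z u) (T z u) (T (T z) u))
      (cong (λ t → shift c z u - e * t) (≡.sym (T-shift c z u))))
    where
    lemma : ∀ c e a b d → a - e * b - c * (b - e * d) ≡ a - c * b - e * (b - c * d)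
    lemma = solve-∀ ℚ-ring

  shift-shift : ∀ c z u → shift c (shift c z) u ≡ z u - 2 * c * T z u + c * c * T (T z) u
  shift-shift c z u = trans (cong (λ t → shift c z u - c * t) (T-shift c z u))
    (lemma c (z u) (T z u) (T (T z) u))
    where
    lemma : ∀ c a b d → a - c * b - c * (b - c * d) ≡ a - 2 * c * b + c * c * d
    lemma = solve-∀ ℚ-ring

  ⟨⟩-T : ∀ x y → ⟨ T x , y ⟩ ≡ ⟨ x , T y ⟩
  ⟨⟩-T x y = trans (sum-cong-≗ λ u → trans (ℚ.*-comm (T x u) (y u)) (*-distribˡ-sum (y u) (λ w → K u w * x w)))
    (trans (∑-comm (λ u w → y u * (K u w * x w)))
      (sum-cong-≗ λ w → trans (sum-cong-≗ λ u → trans (cong (λ k → y u * (k * x w)) (K-sym u w)) (lemma (y u) (K w u) (x w)))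
        (≡.sym (*-distribˡ-sum (x w) (λ u → K w u * y u)))))
    where
    lemma : ∀ y k x → y * (k * x) ≡ x * (k * y)
    lemma = solve-∀ ℚ-ring

  ⟨⟩-shiftˡ : ∀ c x y → ⟨ shift c x , y ⟩ ≡ ⟨ x , y ⟩ - c * ⟨ T x , y ⟩
  ⟨⟩-shiftˡ c x y = trans (sum-cong-≗ λ u → expand (x u) c (T x u) (y u))
    (trans (sum-linear 1 (- c) (λ u → x u * y u) (λ u → T x u * y u)) (collect ⟨ x , y ⟩ c ⟨ T x , y ⟩))
    where
    expand : ∀ x c t y → (x - c * t) * y ≡ 1 * (x * y) + (- c) * (t * y)
    expand = solve-∀ ℚ-ring
    collect : ∀ a c b → 1 * a + (- c) * b ≡ a - c * b
    collect = solve-∀ ℚ-ring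

  ⟨⟩-shiftʳ : ∀ c x y → ⟨ x , shift c y ⟩ ≡ ⟨ x , y ⟩ - c * ⟨ x , T y ⟩
  ⟨⟩-shiftʳ c x y = trans (⟨⟩-comm x (shift c y)) (trans (⟨⟩-shiftˡ c y x)
    (cong₂ (λ a b → a - c * b) (⟨⟩-comm y x) (⟨⟩-comm (T y) x)))

  ⟨⟩-shift : ∀ c x y → ⟨ shift c x , y ⟩ ≡ ⟨ x , shift c y ⟩
  ⟨⟩-shift c x y = trans (⟨⟩-shiftˡ c x y)
    (trans (cong (λ t → ⟨ x , y ⟩ - c * t) (⟨⟩-T x y)) (≡.sym (⟨⟩-shiftʳ c x y)))

  sum-T : ∀ z → sum (T z) ≡ sum z
  sum-T z = trans (∑-comm (λ u w → K u w * z w)) (sum-cong-≗ λ w →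
    trans (sum-cong-≗ λ u → trans (ℚ.*-comm (K u w) (z w)) (cong (z w *_) (K-sym u w)))
      (trans (≡.sym (*-distribˡ-sum (z w) (K w))) (trans (cong (z w *_) (row-sum w)) (ℚ.*-identityʳ (z w)))))

  -- Row u of K is a probability distribution, and the difference of the two sides is the variance
  -- of z under it.
  T²≤ : ∀ z u → T z u * T z u ≤ sum λ w → K u w * (z w * z w)
  T²≤ z u = ≤-from (sum-nonneg λ w → 0≤* (0≤K u w) (0≤² (z w - T z u))) (≡.sym
    (trans (cong (c * c +_) (trans (sum-cong-≗ λ w → expand (K u w) (z w) c)
      (trans (sum-linear 1 1 (λ w → K u w * (z w * z w)) (λ w → (- 2 * c) * (K u w * z w) + c * c * K u w))
        (cong (λ t → 1 * S + 1 * t) (trans (sum-linear (- 2 * c) (c * c) (λ w → K u w * z w) (K u))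
          (cong (λ t → (- 2 * c) * c + c * c * t) (row-sum u)))))))
      (collect c S)))
    where
    c = T z u
    S = sum λ w → K u w * (z w * z w)
    expand : ∀ k z c → k * ((z - c) * (z - c)) ≡ 1 * (k * (z * z)) + 1 * ((- 2 * c) * (k * z) + c * c * k)
    expand = solve-∀ ℚ-ring
    collect : ∀ c S → c * c + (1 * S + 1 * ((- 2 * c) * c + c * c * 1ℚ)) ≡ S
    collect = solve-∀ ℚ-ring

  contraction : ∀ z → ⟨ T z , T z ⟩ ≤ ⟨ z , z ⟩
  contraction z = ≤-trans (sum-mono (T²≤ z)) (≤-reflexive (sum-T (λ w → z w * z w)))

  norm-shift : ∀ c z → ⟨ shift c z , shift c z ⟩ ≡ ⟨ z , z ⟩ - 2 * c * ⟨ z , T z ⟩ + c * c * ⟨ T z , T z ⟩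
  norm-shift c z = trans (⟨⟩-shiftˡ c z (shift c z))
    (trans (cong₂ (λ a b → a - c * b) (⟨⟩-shiftʳ c z z) (trans (⟨⟩-shiftʳ c (T z) z)
      (cong (λ t → t - c * ⟨ T z , T z ⟩) (⟨⟩-T z z))))
    (lemma c ⟨ z , z ⟩ ⟨ z , T z ⟩ ⟨ T z , T z ⟩))
    where
    lemma : ∀ c a b d → a - c * b - c * (b - c * d) ≡ a - 2 * c * b + c * c * d
    lemma = solve-∀ ℚ-ring

  -- The spectral form is (1 - λ)² ≤ 2(1 - λ), whose defect 1 - λ² is exactly the defect of
  -- `contraction`.
  norm-shift₁≤ : ∀ z → ⟨ shift 1 z , shift 1 z ⟩ ≤ 2 * ⟨ z , shift 1 z ⟩
  norm-shift₁≤ z = ≤-from (0≤- (contraction z))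
    (trans (cong (2 *_) (⟨⟩-shiftʳ 1 z z))
      (trans (lemma ⟨ z , z ⟩ ⟨ z , T z ⟩ ⟨ T z , T z ⟩)
        (cong (_+ (⟨ z , z ⟩ - ⟨ T z , T z ⟩)) (≡.sym (norm-shift 1 z)))))
    where
    lemma : ∀ a b d → 2 * (a - 1 * b) ≡ a - 2 * 1 * b + 1 * 1 * d + (a - d)
    lemma = solve-∀ ℚ-ring

  -- Positive semidefiniteness of I - K without eigenvectors: twice the form dominates a squared
  -- norm.
  0≤⟨⟩-shift₁ : ∀ z → 0ℚ ≤ ⟨ z , shift 1 z ⟩
  0≤⟨⟩-shift₁ z = ≤-trans (0≤* {½} ≤-decide (≤-trans (⟨⟩-nonneg (shift 1 z)) (norm-shift₁≤ z)))
    (≤-reflexive (lemma ⟨ z , shift 1 z ⟩))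
    where
    lemma : ∀ a → ½ * (2 * a) ≡ a
    lemma = solve-∀ ℚ-ring

  ⟨⟩-T≤ : ∀ z → ⟨ T z , z ⟩ ≤ ⟨ z , z ⟩
  ⟨⟩-T≤ z = ≤-from (0≤⟨⟩-shift₁ z) (trans (lemma ⟨ z , z ⟩ ⟨ T z , z ⟩)
    (cong (⟨ T z , z ⟩ +_) (trans (cong (λ t → ⟨ z , z ⟩ - 1 * t) (⟨⟩-T z z)) (≡.sym (⟨⟩-shiftʳ 1 z z)))))
    where
    lemma : ∀ a b → a ≡ b + (a - 1 * b)
    lemma = solve-∀ ℚ-ring

  norm-shift≤ : ∀ c z → ⟨ shift c z , shift c z ⟩ ≤ 2 * (⟨ z , z ⟩ + c * c * ⟨ T z , T z ⟩)
  norm-shift≤ c z = ≤-from (⟨⟩-nonneg (shift (- c) z)) (trans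
    (lemma c ⟨ z , z ⟩ ⟨ z , T z ⟩ ⟨ T z , T z ⟩)
    (≡.sym (cong₂ _+_ (norm-shift c z) (norm-shift (- c) z))))
    where
    lemma : ∀ c a b d → 2 * (a + c * c * d) ≡
      a - 2 * c * b + c * c * d + (a - 2 * (- c) * b + (- c) * (- c) * d)
    lemma = solve-∀ ℚ-ring

  norm-shift₁≤4 : ∀ z → ⟨ shift 1 z , shift 1 z ⟩ ≤ 4 * ⟨ z , z ⟩
  norm-shift₁≤4 z = ≤-trans (norm-shift≤ 1 z)
    (≤-from (0≤* {2} ≤-decide (0≤- (contraction z))) (lemma ⟨ z , z ⟩ ⟨ T z , T z ⟩))
    where
    lemma : ∀ a d → 4 * a ≡ 2 * (a + 1 * 1 * d) + 2 * (a - d)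
    lemma = solve-∀ ℚ-ring

  norm-shift₁²≤16 : ∀ z → ⟨ shift 1 (shift 1 z) , shift 1 (shift 1 z) ⟩ ≤ 16 * ⟨ z , z ⟩
  norm-shift₁²≤16 z = ≤-trans (norm-shift₁≤4 (shift 1 z))
    (≤-trans (*-monoˡ 4 ≤-decide (norm-shift₁≤4 z)) (≤-reflexive (lemma ⟨ z , z ⟩)))
    where
    lemma : ∀ a → 4 * (4 * a) ≡ 16 * a
    lemma = solve-∀ ℚ-ring

  norm-shift₁²≤8 : ∀ z → ⟨ shift 1 (shift 1 z) , shift 1 (shift 1 z) ⟩ ≤ 8 * ⟨ z , shift 1 z ⟩
  norm-shift₁²≤8 z = ≤-trans (norm-shift₁≤4 (shift 1 z))
    (≤-trans (*-monoˡ 4 ≤-decide (norm-shift₁≤ z)) (≤-reflexive (lemma ⟨ z , shift 1 z ⟩)))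
    where
    lemma : ∀ a → 4 * (2 * a) ≡ 8 * a
    lemma = solve-∀ ℚ-ring

  -- (a + b + d)² ≤ 3(a² + b² + d²) at every coordinate. The three powers of c are kept apart
  -- because their norms are bounded in different ways later.
  norm-shift-shift≤ : ∀ c z → ⟨ shift c (shift c z) , shift c (shift c z) ⟩ ≤
    3 * (⟨ z , z ⟩ + 4 * (c * c) * ⟨ T z , T z ⟩ + c * c * (c * c) * ⟨ T (T z) , T (T z) ⟩)
  norm-shift-shift≤ c z = ≤-trans (sum-mono pointwise) (≤-reflexive
    (trans (sum-linear 3 3 (λ u → z u * z u) (λ u → 4 * (c * c) * (T z u * T z u) + c * c * (c * c) * (T (T z) u * T (T z) u)))
    (trans (cong (λ t → 3 * ⟨ z , z ⟩ + 3 * t)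
      (sum-linear (4 * (c * c)) (c * c * (c * c)) (λ u → T z u * T z u) (λ u → T (T z) u * T (T z) u)))
    (collect ⟨ z , z ⟩ (4 * (c * c) * ⟨ T z , T z ⟩) (c * c * (c * c) * ⟨ T (T z) , T (T z) ⟩)))))
    where
    collect : ∀ a b d → 3 * a + 3 * (b + d) ≡ 3 * (a + b + d)
    collect = solve-∀ ℚ-ring
    square : ∀ c a b d → 3 * (a * a) + 3 * (4 * (c * c) * (b * b) + c * c * (c * c) * (d * d)) ≡
      (a - 2 * c * b + c * c * d) * (a - 2 * c * b + c * c * d) +
      ((a + 2 * c * b) * (a + 2 * c * b) + (a - c * c * d) * (a - c * c * d) + (2 * c * b + c * c * d) * (2 * c * b + c * c * d))
    square = solve-∀ ℚ-ring
    pointwise : ∀ u → shift c (shift c z) u * shift c (shift c z) u ≤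
      3 * (z u * z u) + 3 * (4 * (c * c) * (T z u * T z u) + c * c * (c * c) * (T (T z) u * T (T z) u))
    pointwise u = ≤-trans (≤-reflexive (cong (λ t → t * t) (shift-shift c z u)))
      (≤-from (0≤+ (0≤+ (0≤² (z u + 2 * c * T z u)) (0≤² (z u - c * c * T (T z) u))) (0≤² (2 * c * T z u + c * c * T (T z) u)))
        (square c (z u) (T z u) (T (T z) u)))

  module Test (h : ℚ) where

    filter : (Fin n → ℚ) → Fin n → ℚ
    filter y = shift 1 (shift h y)

    -- At y = e_v this is column v of the Gram matrix M.
    filter² : (Fin n → ℚ) → Fin n → ℚ
    filter² y = shift h (shift 1 (filter y))

    -- At y = e_v this is the diagonal entry of K⁴(I - K) at v, the gain that pays for the quadratic
    -- error.
    gap : (Fin n → ℚ) → ℚ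
    gap y = ⟨ T (T y) , shift 1 (T (T y)) ⟩

    ⟨⟩-filter : ∀ x y → ⟨ filter x , filter y ⟩ ≡ ⟨ x , filter² y ⟩
    ⟨⟩-filter x y = trans (⟨⟩-shift 1 (shift h x) (filter y)) (⟨⟩-shift h x (shift 1 (filter y)))

    norm-filter≤ : ∀ y → ⟨ filter y , filter y ⟩ ≤ 8 * (⟨ y , y ⟩ + h * h * ⟨ T y , T y ⟩)
    norm-filter≤ y = ≤-trans (norm-shift₁≤4 (shift h y)) (≤-trans (*-monoˡ 4 ≤-decide (norm-shift≤ h y))
      (≤-reflexive (lemma (⟨ y , y ⟩ + h * h * ⟨ T y , T y ⟩))))
      where
      lemma : ∀ a → 4 * (2 * a) ≡ 8 * a
      lemma = solve-∀ ℚ-ring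

    -- The factors commute. With (I - K)² innermost, the norm can be expanded in powers of h.
    filter²-low : ∀ y u → filter² y u ≡ shift h (shift h (shift 1 (shift 1 y))) u
    filter²-low y = shift-cong h λ u → trans (shift-cong 1 (shift-comm 1 h y) u) (shift-comm 1 h (shift 1 y) u)

    -- An outermost I - K can be moved across the inner product onto `T y`, where it forms
    -- `shift 1 (T y)`.
    filter²-outer : ∀ y u → filter² y u ≡ shift 1 (shift h (shift h (shift 1 y))) u
    filter²-outer y u = trans (shift-comm h 1 (filter y) u)
      (shift-cong 1 (shift-cong h (shift-comm 1 h y)) u)

    -- The first two terms use the crude bound (1 - λ)⁴ ≤ 16. The h⁴ term needs (1 - λ)⁴ ≤ 8(1 - λ),
    -- so that `gap` itself appears.
    norm-filter²≤ : ∀ y → ⟨ filter² y , filter² y ⟩ ≤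
      3 * (16 * ⟨ y , y ⟩ + 4 * (h * h) * (16 * ⟨ T y , T y ⟩) + h * h * (h * h) * (8 * gap y))
    norm-filter²≤ y = ≤-trans (≤-reflexive (⟨⟩-cong (filter²-low y) (filter²-low y)))
      (≤-trans (norm-shift-shift≤ h (shift 1 (shift 1 y)))
        (*-monoˡ 3 ≤-decide (ℚ.+-mono-≤ (ℚ.+-mono-≤ (norm-shift₁²≤16 y)
          (*-monoˡ (4 * (h * h)) (0≤* {4} ≤-decide (0≤² h))
            (≤-trans (≤-reflexive (⟨⟩-cong (T-shift² 1 y) (T-shift² 1 y))) (norm-shift₁²≤16 (T y)))))
          (*-monoˡ (h * h * (h * h)) (0≤² (h * h))
            (≤-trans (≤-reflexive (⟨⟩-cong TT-shift² TT-shift²)) (norm-shift₁²≤8 (T (T y))))))))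
      where
      TT-shift² : ∀ u → T (T (shift 1 (shift 1 y))) u ≡ shift 1 (shift 1 (T (T y))) u
      TT-shift² u = trans (T-cong (T-shift² 1 y) u) (T-shift² 1 (T y) u)

    -- The quadratic form at y of the polynomial identity K(I - K)²(I - hK)² = K - 2K² + K³ - 2hK²(I
    -- - K)² + h²(K³ - K⁴ - K⁴(I - K)).
    ⟨T⟩-filter² : ∀ y → ⟨ T y , filter² y ⟩ ≡
      ⟨ T y , y ⟩ - 2 * ⟨ T y , T y ⟩ + ⟨ T (T y) , T y ⟩
        - 2 * h * ⟨ shift 1 (T y) , shift 1 (T y) ⟩
        + h * h * (⟨ T (T y) , T y ⟩ - ⟨ T (T y) , T (T y) ⟩ - gap y)
    ⟨T⟩-filter² y = trans (⟨⟩-congʳ y₁ (filter²-outer y))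
      (trans (≡.sym (⟨⟩-shift 1 y₁ (shift h (shift h p))))
      (trans (⟨⟩-shiftʳ h s₁ (shift h p))
      (trans (cong₂ (λ a b → a - h * b) (⟨⟩-shiftʳ h s₁ p)
        (trans (⟨⟩-congʳ s₁ (T-shift h p)) (⟨⟩-shiftʳ h s₁ (T p))))
      (trans (cong₂ (λ a b → ⟨ s₁ , p ⟩ - h * a - h * (a - h * b))
        (⟨⟩-congʳ s₁ (T-shift 1 y))
        (⟨⟩-congʳ s₁ λ u → trans (T-cong (T-shift 1 y) u) (T-shift 1 y₁ u)))
      (trans (cong₂ (λ a b → a - h * Y - h * (Y - h * b)) first last)
        (lemma h ⟨ y₁ , y ⟩ ⟨ y₁ , y₁ ⟩ ⟨ y₂ , y₁ ⟩ ⟨ y₂ , y₂ ⟩ (gap y) Y))))))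
      where
      y₁ = T y
      y₂ = T y₁
      p  = shift 1 y
      s₁ = shift 1 y₁
      Y  = ⟨ s₁ , s₁ ⟩
      first : ⟨ s₁ , p ⟩ ≡ ⟨ y₁ , y ⟩ - 1 * ⟨ y₁ , y₁ ⟩ - 1 * (⟨ y₁ , y₁ ⟩ - 1 * ⟨ y₂ , y₁ ⟩)
      first = trans (⟨⟩-shiftˡ 1 y₁ p) (cong₂ (λ a b → a - 1 * b) (⟨⟩-shiftʳ 1 y₁ y)
        (trans (⟨⟩-shiftʳ 1 y₂ y) (cong (λ t → t - 1 * ⟨ y₂ , y₁ ⟩) (⟨⟩-T y₁ y))))
      last : ⟨ s₁ , shift 1 y₂ ⟩ ≡ ⟨ y₂ , y₁ ⟩ - 1 * ⟨ y₂ , y₂ ⟩ - 1 * gap y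
      last = trans (⟨⟩-shiftˡ 1 y₁ (shift 1 y₂)) (cong (λ t → t - 1 * gap y)
        (trans (⟨⟩-shiftʳ 1 y₁ y₂) (cong₂ (λ a b → a - 1 * b) (⟨⟩-comm y₁ y₂) (≡.sym (⟨⟩-T y₁ y₂)))))
      lemma : ∀ h a b c d g Y →
        a - 1 * b - 1 * (b - 1 * c) - h * Y - h * (Y - h * (c - 1 * d - 1 * g))
        ≡ a - 2 * b + c - 2 * h * Y + h * h * (c - d - g)
      lemma = solve-∀ ℚ-ring

  norm-shift₁-T : ∀ y → ⟨ shift 1 (T y) , shift 1 (T y) ⟩ ≡
    ⟨ T y , T y ⟩ - 2 * ⟨ T (T y) , T y ⟩ + ⟨ T (T y) , T (T y) ⟩
  norm-shift₁-T y = trans (norm-shift 1 (T y))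
    (trans (cong (λ t → ⟨ T y , T y ⟩ - 2 * 1 * t + 1 * 1 * ⟨ T (T y) , T (T y) ⟩) (⟨⟩-comm (T y) (T (T y))))
      (lemma ⟨ T y , T y ⟩ ⟨ T (T y) , T y ⟩ ⟨ T (T y) , T (T y) ⟩))
    where
    lemma : ∀ a b d → a - 2 * 1 * b + 1 * 1 * d ≡ a - 2 * b + d
    lemma = solve-∀ ℚ-ring

-- Unit vectors and the trace estimate

unit : ∀ {n} → Fin n → Fin n → ℚ
unit zero    zero    = 1ℚ
unit zero    (suc u) = 0ℚ
unit (suc v) zero    = 0ℚ
unit (suc v) (suc u) = unit v u

sum-unit : ∀ {n} (f : Fin n → ℚ) v → sum (λ u → f u * unit v u) ≡ f v
sum-unit {suc n} f zero = trans
  (cong₂ _+_ (ℚ.*-identityʳ (f zero))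
    (trans (sum-cong-≗ λ u → ℚ.*-zeroʳ (f (suc u))) (sum-zero n)))
  (ℚ.+-identityʳ (f zero))
sum-unit {suc n} f (suc v) = trans
  (cong₂ _+_ (ℚ.*-zeroʳ (f zero)) (sum-unit (λ u → f (suc u)) v))
  (ℚ.+-identityˡ (f (suc v)))

⟨unit⟩ : ∀ {n} (f : Fin n → ℚ) v → ⟨ unit v , f ⟩ ≡ f v
⟨unit⟩ f v = trans (⟨⟩-comm (unit v) f) (sum-unit f v)

unit-diag : ∀ {n} (v : Fin n) → unit v v ≡ 1ℚ
unit-diag zero    = refl
unit-diag (suc v) = unit-diag v

-- The scale of the rounded vectors, 1/32. It makes 480δ² = 15/32, which keeps the quadratic error
-- below half of the main gain (see `weighted≤`).
δ : ℚ
δ = ½ * ½ * ½ * ½ * ½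

module Spectral {n} (K : Fin n → Fin n → ℚ) (K-sym : ∀ u v → K u v ≡ K v u)
                (0≤K : ∀ u v → 0ℚ ≤ K u v) (row-sum : ∀ u → sum (K u) ≡ 1ℚ)
                (K-diag : ∀ v → K v v ≡ 0ℚ) (ι : ℚ) (K≤ι : ∀ u v → K u v ≤ ι)
                (row-sum² : ∀ v → sum (λ u → K u v * K u v) ≡ ι)
                (ρ : ℚ) (nρ≡1 : ℕ→ℚ n * ρ ≡ 1ℚ) where

  open Stochastic K K-sym 0≤K row-sum

  e₁ e₂ : Fin n → Fin n → ℚ
  e₁ v = T (unit v)
  e₂ v = T (e₁ v)

  e₁-eq : ∀ v u → e₁ v u ≡ K u v
  e₁-eq v u = sum-unit (K u) v

  cube : Fin n → ℚ
  cube v = ⟨ e₂ v , e₁ v ⟩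

  trace₃ : ℚ
  trace₃ = sum cube

  slack : Fin n → ℚ
  slack v = ⟨ shift 1 (e₁ v) , shift 1 (e₁ v) ⟩

  norm-e₁ : ∀ v → ⟨ e₁ v , e₁ v ⟩ ≡ ι
  norm-e₁ v = trans (⟨⟩-cong (e₁-eq v) (e₁-eq v)) (row-sum² v)

  ⟨e₁,unit⟩ : ∀ v → ⟨ e₁ v , unit v ⟩ ≡ 0ℚ
  ⟨e₁,unit⟩ v = trans (sum-unit (e₁ v) v) (trans (e₁-eq v v) (K-diag v))

  cube≤ι : ∀ v → cube v ≤ ι
  cube≤ι v = ≤-trans (⟨⟩-T≤ (e₁ v)) (≤-reflexive (norm-e₁ v))

  -- K²e_v has coordinate sum 1, so its squared norm is at least 1/n, with the variance around `ρ`
  -- as the defect. Summed over v this is tr K⁴ ≥ 1, the contribution of the trivial eigenvalue.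
  ρ≤norm-e₂ : ∀ v → ρ ≤ ⟨ e₂ v , e₂ v ⟩
  ρ≤norm-e₂ v = ≤-from (sum-nonneg λ u → 0≤² (e₂ v u - ρ)) (≡.sym
    (trans (cong (ρ +_) (trans (sum-cong-≗ λ u → expand (e₂ v u) ρ)
      (trans (sum-linear 1 1 (λ u → e₂ v u * e₂ v u) (λ u → (- 2 * ρ) * e₂ v u + 1 * (ρ * ρ)))
        (cong (λ t → 1 * E + 1 * t) (trans (sum-linear (- 2 * ρ) 1 (e₂ v) (λ _ → ρ * ρ))
          (cong₂ (λ a b → (- 2 * ρ) * a + 1 * b) total (trans (sum-const n (ρ * ρ))
            (trans (≡.sym (ℚ.*-assoc (ℕ→ℚ n) ρ ρ)) (cong (_* ρ) nρ≡1)))))))))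
    (collect E ρ)))
    where
    E = ⟨ e₂ v , e₂ v ⟩
    total : sum (e₂ v) ≡ 1ℚ
    total = trans (sum-T (e₁ v)) (trans (sum-T (unit v))
      (trans (sum-cong-≗ λ u → ≡.sym (ℚ.*-identityˡ (unit v u))) (sum-unit (λ _ → 1ℚ) v)))
    expand : ∀ z c → (z - c) * (z - c) ≡ 1 * (z * z) + 1 * ((- 2 * c) * z + 1 * (c * c))
    expand = solve-∀ ℚ-ring
    collect : ∀ E ρ → ρ + (1 * E + 1 * ((- 2 * ρ) * 1ℚ + 1 * (1ℚ * ρ))) ≡ E
    collect = solve-∀ ℚ-ring

  sum-slack-nonneg : 0ℚ ≤ sum slack
  sum-slack-nonneg = sum-nonneg λ v → ⟨⟩-nonneg (shift 1 (e₁ v))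

  -- The left side is tr K² - 2 tr K³ + tr K⁴ with tr K² = n/d and with tr K⁴ replaced by its lower
  -- bound 1.
  sum-slack≥ : ℕ→ℚ n * ι - 2 * trace₃ + 1 ≤ sum slack
  sum-slack≥ = ≤-trans (≤-reflexive (≡.sym
    (trans (sum-linear 1 (- 2) (λ _ → ι + ρ) cube)
      (trans (cong (λ t → 1 * t + (- 2) * trace₃) (sum-const n (ι + ρ)))
        (trans (lemma (ℕ→ℚ n) ι ρ trace₃) (cong (λ t → ℕ→ℚ n * ι - 2 * trace₃ + t) nρ≡1))))))
    (sum-mono λ v → ≤-from (0≤- (ρ≤norm-e₂ v)) (trans (norm-shift₁-T (unit v))
      (trans (cong (λ t → t - 2 * cube v + ⟨ e₂ v , e₂ v ⟩) (norm-e₁ v)) (split ι (cube v) ⟨ e₂ v , e₂ v ⟩ ρ))))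
    where
    lemma : ∀ n ι ρ t → 1 * (n * (ι + ρ)) + (- 2) * t ≡ n * ι - 2 * t + n * ρ
    lemma = solve-∀ ℚ-ring
    split : ∀ ι c f ρ → ι - 2 * c + f ≡ 1 * (ι + ρ) + (- 2) * c + (f - ρ)
    split = solve-∀ ℚ-ring

  module _ (h : ℚ) (0≤ι : 0ℚ ≤ ι) (ι≤1 : ι ≤ 1ℚ) (h²ι≤1 : h * h * ι ≤ 1ℚ)
           (k : ℕ) (kι : ℕ→ℚ k * (ι * (δ * (½ * ½ * ½))) ≡ 1ℚ) where

    open Test h

    private
      -- Equals 1/(256d). The splitting error 2κ² per vertex is then δ²ι²/32, of lower order than
      -- the gain δ²ι.
      κ : ℚ
      κ = ι * (δ * (½ * ½ * ½))

      X : Fin n → Fin n → ℚ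
      X j v = δ * filter (unit v) j

      z : Fin n → Fin n → ℚ
      z v = filter² (unit v)

      gram-X : ∀ u v → sum (λ j → X j u * X j v) ≡ δ * δ * z v u
      gram-X u v = trans (sum-cong-≗ λ j → rearrange δ (filter (unit u) j) (filter (unit v) j))
        (trans (≡.sym (*-distribˡ-sum (δ * δ) (λ j → filter (unit u) j * filter (unit v) j)))
          (cong (δ * δ *_) (trans (⟨⟩-filter (unit u) (unit v)) (⟨unit⟩ (z v) u))))
        where
        rearrange : ∀ c a b → c * a * (c * b) ≡ c * c * (a * b)
        rearrange = solve-∀ ℚ-ring

      norm-X : ∀ v → sum (λ j → X j v * X j v) ≤ ½ * ½
      norm-X v = ≤-trans (≤-reflexive (trans (gram-X v v) (cong (δ * δ *_)
          (trans (≡.sym (⟨unit⟩ (z v) v)) (≡.sym (⟨⟩-filter (unit v) (unit v)))))))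
        (≤-trans (*-monoˡ (δ * δ) ≤-decide (≤-trans (norm-filter≤ (unit v))
            (≤-reflexive (cong₂ (λ a b → 8 * (a + h * h * b)) (trans (⟨unit⟩ (unit v) v) (unit-diag v)) (norm-e₁ v)))))
          (≤-trans (*-monoˡ (δ * δ) ≤-decide (*-monoˡ 8 ≤-decide (ℚ.+-monoʳ-≤ 1ℚ h²ι≤1))) ≤-decide))

      weighted : Fin n → ℚ
      weighted v = sum λ u → K u v * (δ * δ * z v u + 2 * (δ * δ * z v u * (δ * δ * z v u)) + 2 * (κ * κ))

      weighted-expand : ∀ v → weighted v ≡
        δ * δ * ⟨ e₁ v , z v ⟩ + 1 * (2 * (δ * δ) * (δ * δ) * sum (λ u → K u v * (z v u * z v u)) + 2 * (κ * κ) * 1ℚ)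
      weighted-expand v = trans (sum-cong-≗ λ u → expand (K u v) (z v u) (δ * δ) (κ * κ))
        (trans (sum-linear (δ * δ) 1 (λ u → K u v * z v u)
          (λ u → 2 * (δ * δ) * (δ * δ) * (K u v * (z v u * z v u)) + 2 * (κ * κ) * K u v))
        (cong₂ (λ a b → δ * δ * a + 1 * b)
          (sum-cong-≗ λ u → cong (_* z v u) (≡.sym (e₁-eq v u)))
          (trans (sum-linear (2 * (δ * δ) * (δ * δ)) (2 * (κ * κ)) (λ u → K u v * (z v u * z v u)) (λ u → K u v))
            (cong (λ t → 2 * (δ * δ) * (δ * δ) * sum (λ u → K u v * (z v u * z v u)) + 2 * (κ * κ) * t)
              (trans (sum-cong-≗ λ u → K-sym u v) (row-sum v))))))
        where
        expand : ∀ k z c q → k * (c * z + 2 * (c * z * (c * z)) + 2 * q) ≡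
          c * (k * z) + 1 * (2 * c * c * (k * (z * z)) + 2 * q * k)
        expand = solve-∀ ℚ-ring

      weighted-square : ∀ v → sum (λ u → K u v * (z v u * z v u)) ≤ ι * ⟨ z v , z v ⟩
      weighted-square v = ≤-trans
        (sum-mono λ u → *-mono (0≤K u v) (0≤² (z v u)) (K≤ι u v) ≤-refl)
        (≤-reflexive (≡.sym (*-distribˡ-sum ι (λ u → z v u * z v u))))

      limit : Fin n → ℚ
      limit v = - (δ * δ) * (½ * ι + 2 * h * slack v - h * h * (cube v - ρ))

      -- Since (K³)_vv ≤ ι, the terms -2ι + (K³)_vv leave a gain of δ²ι. The quadratic error costs
      -- 2δ⁴ι·3·(16 + 64h²ι), at most 15/32 of it, and the splitting error at most 1/32, so ½δ²ι
      -- survives. The remaining quadratic error 48δ⁴h⁴ι·gap is at most 48δ² times the gain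
      -- δ²h²·gap.
      weighted≤ : ∀ v → weighted v ≤ limit v
      weighted≤ v = ≤-trans (≤-reflexive (weighted-expand v))
        (≤-trans (≤-reflexive (cong (λ t → δ * δ * t + rest) main))
        (≤-from (0≤+ (0≤+ (0≤+ (0≤+ (0≤* (0≤² δ) (0≤- (cube≤ι v)))
                                    (0≤* (0≤² δ) (0≤* (0≤² h) (0≤- (ρ≤norm-e₂ v)))))
                               (0≤* {2 * (δ * δ) * (δ * δ)} ≤-decide
                                  (0≤+ (0≤- (weighted-square v)) (0≤* 0≤ι (0≤- energy)))))
                          (0≤* {δ * δ * (δ * (½ * ½))} ≤-decide (0≤* 0≤ι (0≤+ (0≤* {48} ≤-decide (0≤- h²ι≤1)) (0≤* {4} ≤-decide (0≤- ι≤1))))))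
                     (0≤* {δ * δ * (δ * (½ * ½ * ½))} ≤-decide (0≤* (0≤* (0≤² h) (0≤⟨⟩-shift₁ (e₂ v)))
                        (0≤+ (0≤* {12} ≤-decide (0≤- h²ι≤1)) (≤-decide {0ℚ} {244})))))
          (certificate ι h ρ (cube v) ⟨ e₂ v , e₂ v ⟩ (gap (unit v)) (slack v) ⟨ z v , z v ⟩ (sum λ u → K u v * (z v u * z v u)))))
        where
        rest : ℚ
        rest = 1 * (2 * (δ * δ) * (δ * δ) * sum (λ u → K u v * (z v u * z v u)) + 2 * (κ * κ) * 1ℚ)
        main : ⟨ e₁ v , z v ⟩ ≡ 0ℚ - 2 * ι + cube v - 2 * h * slack v
          + h * h * (cube v - ⟨ e₂ v , e₂ v ⟩ - gap (unit v))
        main = trans (⟨T⟩-filter² (unit v)) (cong₂ (λ a b → a - 2 * b + cube v - 2 * h * slack v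
          + h * h * (cube v - ⟨ e₂ v , e₂ v ⟩ - gap (unit v))) (⟨e₁,unit⟩ v) (norm-e₁ v))
        energy : ⟨ z v , z v ⟩ ≤ 3 * (16 * 1ℚ + 4 * (h * h) * (16 * ι) + h * h * (h * h) * (8 * gap (unit v)))
        energy = ≤-trans (norm-filter²≤ (unit v)) (≤-reflexive
          (cong₂ (λ a b → 3 * (16 * a + 4 * (h * h) * (16 * b) + h * h * (h * h) * (8 * gap (unit v))))
            (trans (⟨unit⟩ (unit v) v) (unit-diag v)) (norm-e₁ v)))
        certificate : ∀ ι h ρ t f g Y E W →
          - (δ * δ) * (½ * ι + 2 * h * Y - h * h * (t - ρ)) ≡
          δ * δ * (0ℚ - 2 * ι + t - 2 * h * Y + h * h * (t - f - g))
            + 1 * (2 * (δ * δ) * (δ * δ) * W + 2 * (ι * (δ * (½ * ½ * ½)) * (ι * (δ * (½ * ½ * ½)))) * 1ℚ)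
            + (δ * δ * (ι - t) + δ * δ * (h * h * (f - ρ))
              + 2 * (δ * δ) * (δ * δ) * ((ι * E - W)
                + ι * (3 * (16 * 1ℚ + 4 * (h * h) * (16 * ι) + h * h * (h * h) * (8 * g)) - E))
              + δ * δ * (δ * (½ * ½)) * (ι * (48 * (1ℚ - h * h * ι) + 4 * (1ℚ - ι)))
              + δ * δ * (δ * (½ * ½ * ½)) * (h * h * g * (12 * (1ℚ - h * h * ι) + 244)))
        certificate = solve-∀ ℚ-ring

    spectral-rounding : ∃ λ (J : Fin n → ℚ) → (∀ v → J v * J v ≤ 2) ×
      ⟪ K , (λ u v → J u * J v) ⟫ ≤
        - (δ * δ) * (½ * (ℕ→ℚ n * ι) + 2 * h * sum slack - h * h * (trace₃ - 1))
    spectral-rounding = proj₁ rounded , proj₁ (proj₂ rounded) , ≤-trans (proj₂ (proj₂ rounded))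
      (≤-trans (≤-reflexive (trans (⟪⟫-cong K λ u v → cong (λ g → g + 2 * (g * g) + 2 * (κ * κ)) (gram-X u v))
          (∑-comm (λ u v → K u v * (δ * δ * z v u + 2 * (δ * δ * z v u * (δ * δ * z v u)) + 2 * (κ * κ))))))
      (≤-trans (sum-mono weighted≤) (≤-reflexive total)))
      where
      0≤κ : 0ℚ ≤ κ
      0≤κ = 0≤* 0≤ι ≤-decide
      κ≤½ : κ ≤ ½
      κ≤½ = ≤-trans (*-mono 0≤ι (≤-decide {0ℚ} {½}) ι≤1 ≤-decide) ≤-decide
      rounded = rounding K 0≤K X k κ kι 0≤κ κ≤½ norm-X
      total : sum limit ≡ - (δ * δ) * (½ * (ℕ→ℚ n * ι) + 2 * h * sum slack - h * h * (trace₃ - 1))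
      total = trans (sum-cong-≗ λ v → split (- (δ * δ)) ι h (slack v) (cube v) ρ)
        (trans (sum-linear 1 1 (λ _ → - (δ * δ) * (½ * ι + h * h * ρ)) (λ v → - (δ * δ) * (2 * h) * slack v + (- (δ * δ)) * (- (h * h)) * cube v))
        (trans (cong₂ (λ a b → 1 * a + 1 * b) (sum-const n (- (δ * δ) * (½ * ι + h * h * ρ)))
          (sum-linear (- (δ * δ) * (2 * h)) ((- (δ * δ)) * (- (h * h))) slack cube))
        (trans (collect (- (δ * δ)) (ℕ→ℚ n) ι h (sum slack) trace₃ ρ)
          (cong (λ t → - (δ * δ) * (½ * (ℕ→ℚ n * ι) + 2 * h * sum slack - h * h * (trace₃ - t))) nρ≡1))))
        where
        split : ∀ c ι h Y t ρ → c * (½ * ι + 2 * h * Y - h * h * (t - ρ)) ≡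
          1 * (c * (½ * ι + h * h * ρ)) + 1 * (c * (2 * h) * Y + c * (- (h * h)) * t)
        split = solve-∀ ℚ-ring
        collect : ∀ c n ι h Y t ρ → 1 * (n * (c * (½ * ι + h * h * ρ))) + 1 * (c * (2 * h) * Y + c * (- (h * h)) * t) ≡
          c * (½ * (n * ι) + 2 * h * Y - h * h * (t - n * ρ))
        collect = solve-∀ ℚ-ring

-- Sums over unordered pairs and triples

-- The pairs i < j are enumerated by peeling off vertex zero, so that inductions meet no order
-- comparison.
upper₂ : ∀ {n} → (Fin n → Fin n → ℚ) → ℚ
upper₂ {zero}  F = 0ℚ
upper₂ {suc n} F = sum (λ j → F zero (suc j)) + upper₂ (λ i j → F (suc i) (suc j))

upper₃ : ∀ {n} → (Fin n → Fin n → Fin n → ℚ) → ℚ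
upper₃ {zero}  F = 0ℚ
upper₃ {suc n} F = upper₂ (λ j k → F zero (suc j) (suc k)) + upper₃ (λ i j k → F (suc i) (suc j) (suc k))

indicator : Bool → ℚ
indicator b = ℕ→ℚ (𝟙 b)

indicator-∧ : ∀ a b → indicator (a ∧ b) ≡ indicator a * indicator b
indicator-∧ true  b = ≡.sym (ℚ.*-identityˡ (indicator b))
indicator-∧ false b = ≡.sym (ℚ.*-zeroˡ (indicator b))

0≤indicator : ∀ b → 0ℚ ≤ indicator b
0≤indicator b = ℕ→ℚ-nonneg (𝟙 b)

indicator≤1 : ∀ b → indicator b ≤ 1ℚ
indicator≤1 true  = ≤-refl
indicator≤1 false = ≤-decide

indicator² : ∀ b → indicator b * indicator b ≡ indicator b
indicator² true  = refl
indicator² false = refl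

ℕ→ℚ-sumF : ∀ {n} (f : Fin n → ℕ) → ℕ→ℚ (sumF f) ≡ sum (λ i → ℕ→ℚ (f i))
ℕ→ℚ-sumF {zero}  f = refl
ℕ→ℚ-sumF {suc n} f = trans (ℕ→ℚ-+ (f zero) (sumF (λ i → f (suc i))))
  (cong (ℕ→ℚ (f zero) +_) (ℕ→ℚ-sumF (λ i → f (suc i))))

sum-0* : ∀ {n} (f : Fin n → ℚ) → sum (λ i → 0ℚ * f i) ≡ 0ℚ
sum-0* {n} f = trans (sum-cong-≗ λ i → ℚ.*-zeroˡ (f i)) (sum-zero n)

-- Only the `does` components of the two decisions agree definitionally, hence the detour through
-- them.
suc-<ᵇ : ∀ {n} (i j : Fin n) → (suc i <ᵇ suc j) ≡ (i <ᵇ j)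
suc-<ᵇ i j = trans (isYes≗does (suc i <? suc j)) (≡.sym (isYes≗does (i <? j)))

upper₂-indicator : ∀ {n} (F : Fin n → Fin n → ℚ) →
  (sum λ i → sum λ j → indicator (i <ᵇ j) * F i j) ≡ upper₂ F
upper₂-indicator {zero}  F = refl
upper₂-indicator {suc n} F = cong₂ _+_
  (trans (cong₂ _+_ (ℚ.*-zeroˡ (F zero zero)) (sum-cong-≗ λ j → ℚ.*-identityˡ (F zero (suc j)))) (ℚ.+-identityˡ (sum λ j → F zero (suc j))))
  (trans (sum-cong-≗ λ i → trans (cong₂ _+_ (ℚ.*-zeroˡ (F (suc i) zero))
      (sum-cong-≗ λ j → cong (λ b → indicator b * F (suc i) (suc j)) (suc-<ᵇ i j)))
    (ℚ.+-identityˡ _))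
    (upper₂-indicator (λ i j → F (suc i) (suc j))))

upper₃-indicator : ∀ {n} (F : Fin n → Fin n → Fin n → ℚ) →
  (sum λ i → sum λ j → sum λ k → indicator (i <ᵇ j) * (indicator (j <ᵇ k) * F i j k)) ≡ upper₃ F
upper₃-indicator {zero}  F = refl
upper₃-indicator {suc n} F = cong₂ _+_
  (trans (cong₂ _+_ (sum-0* (λ k → indicator (zero {n} <ᵇ k) * F zero zero k))
    (sum-cong-≗ λ j → trans (cong₂ _+_ (trans (ℚ.*-identityˡ (0ℚ * F zero (suc j) zero)) (ℚ.*-zeroˡ (F zero (suc j) zero)))
        (sum-cong-≗ λ k → trans (ℚ.*-identityˡ _) (cong (λ b → indicator b * F zero (suc j) (suc k)) (suc-<ᵇ j k))))
      (ℚ.+-identityˡ _)))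
    (trans (ℚ.+-identityˡ _) (upper₂-indicator (λ j k → F zero (suc j) (suc k)))))
  (trans (sum-cong-≗ λ i → trans (cong₂ _+_ (sum-0* (λ k → indicator (zero {n} <ᵇ k) * F (suc i) zero k))
      (sum-cong-≗ λ j → trans (cong₂ _+_
          (trans (cong (indicator (suc i <ᵇ suc j) *_) (ℚ.*-zeroˡ (F (suc i) (suc j) zero))) (ℚ.*-zeroʳ (indicator (suc i <ᵇ suc j))))
          (sum-cong-≗ λ k → cong₂ (λ a b → indicator a * (indicator b * F (suc i) (suc j) (suc k))) (suc-<ᵇ i j) (suc-<ᵇ j k)))
        (ℚ.+-identityˡ _)))
      (ℚ.+-identityˡ _))
    (upper₃-indicator (λ i j k → F (suc i) (suc j) (suc k))))

sum-upper₂ : ∀ {n} (F : Fin n → Fin n → ℚ) → (∀ i j → F i j ≡ F j i) → (∀ i → F i i ≡ 0ℚ) →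
  (sum λ i → sum λ j → F i j) ≡ 2 * upper₂ F
sum-upper₂ {zero}  F F-sym F-diag = refl
sum-upper₂ {suc n} F F-sym F-diag = trans
  (cong₂ (λ a b → a + first + b) (F-diag zero)
    (trans (∑-distrib-+ (λ i → F (suc i) zero) (λ i → sum λ j → F (suc i) (suc j)))
      (cong₂ _+_ (sum-cong-≗ λ i → F-sym (suc i) zero)
        (sum-upper₂ (λ i j → F (suc i) (suc j)) (λ i j → F-sym (suc i) (suc j)) (λ i → F-diag (suc i))))))
  (lemma first (upper₂ (λ i j → F (suc i) (suc j))))
  where
  first = sum λ j → F zero (suc j)
  lemma : ∀ a u → 0ℚ + a + (a + 2 * u) ≡ 2 * (a + u)
  lemma = solve-∀ ℚ-ring

-- The two transpositions generate all permutations of the arguments. They give each increasing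
-- triple its six orders and carry the vanishing at i = j to the other coincidences.
sum-upper₃ : ∀ {n} (F : Fin n → Fin n → Fin n → ℚ) →
  (∀ i j k → F i j k ≡ F j i k) → (∀ i j k → F i j k ≡ F i k j) → (∀ i k → F i i k ≡ 0ℚ) →
  (sum λ i → sum λ j → sum λ k → F i j k) ≡ 6 * upper₃ F
sum-upper₃ {zero}  F swap₁₂ swap₂₃ F-diag = refl
sum-upper₃ {suc n} F swap₁₂ swap₂₃ F-diag = trans
  (cong₂ _+_
    (cong₂ _+_ (trans (cong₂ _+_ (F-diag zero zero) (trans (sum-cong-≗ λ k → F-diag zero (suc k)) (sum-zero n))) (ℚ.+-identityˡ 0ℚ))
      (trans (sum-cong-≗ λ j → trans (cong (_+ sum (λ k → F zero (suc j) (suc k)))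
          (trans (swap₂₃ zero (suc j) zero) (F-diag zero (suc j)))) (ℚ.+-identityˡ _))
        pairs))
    (trans (∑-distrib-+ (λ i → F (suc i) zero zero + sum (λ k → F (suc i) zero (suc k)))
                        (λ i → sum λ j → F (suc i) (suc j) zero + sum (λ k → F (suc i) (suc j) (suc k))))
      (cong₂ _+_
        (trans (sum-cong-≗ λ i → trans (cong₂ _+_
            (trans (swap₁₂ (suc i) zero zero) (trans (swap₂₃ zero (suc i) zero) (F-diag zero (suc i))))
            (sum-cong-≗ λ k → swap₁₂ (suc i) zero (suc k)))
          (ℚ.+-identityˡ _)) pairs)
        (trans (sum-cong-≗ λ i → ∑-distrib-+ (λ j → F (suc i) (suc j) zero) (λ j → sum λ k → F (suc i) (suc j) (suc k)))
          (trans (∑-distrib-+ (λ i → sum λ j → F (suc i) (suc j) zero) (λ i → sum λ j → sum λ k → F (suc i) (suc j) (suc k)))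
            (cong₂ _+_
              (trans (sum-cong-≗ λ i → sum-cong-≗ λ j → trans (swap₂₃ (suc i) (suc j) zero) (swap₁₂ (suc i) zero (suc j))) pairs)
              (sum-upper₃ (λ i j k → F (suc i) (suc j) (suc k)) (λ i j k → swap₁₂ (suc i) (suc j) (suc k))
                (λ i j k → swap₂₃ (suc i) (suc j) (suc k)) (λ i k → F-diag (suc i) (suc k)))))))))
  (lemma (upper₂ λ j k → F zero (suc j) (suc k)) (upper₃ λ i j k → F (suc i) (suc j) (suc k)))
  where
  pairs : (sum λ j → sum λ k → F zero (suc j) (suc k)) ≡ 2 * upper₂ (λ j k → F zero (suc j) (suc k))
  pairs = sum-upper₂ (λ j k → F zero (suc j) (suc k)) (λ j k → swap₂₃ zero (suc j) (suc k))
    (λ j → trans (swap₁₂ zero (suc j) (suc j)) (trans (swap₂₃ (suc j) zero (suc j)) (F-diag (suc j) zero)))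
  lemma : ∀ a b → 0ℚ + 2 * a + (2 * a + (2 * a + 6 * b)) ≡ 6 * (a + b)
  lemma = solve-∀ ℚ-ring

-- From [-1, 1]-valued to sign vectors

sign : Bool → ℚ
sign true  = 1ℚ
sign false = - 1ℚ

signs : ∀ {n} → Vec Bool n → Fin n → ℚ
signs P i = sign (lookup P i)

x²≤1⇒x≤1 : ∀ x → x * x ≤ 1ℚ → x ≤ 1ℚ
x²≤1⇒x≤1 x p with ℚ.≤-total x 1ℚ
... | inj₁ q = q
... | inj₂ q = ≤-trans (≤-from (0≤* (≤-trans ≤-decide q) (0≤- q)) (lemma x)) p
  where
  lemma : ∀ x → x * x ≡ x + x * (x - 1ℚ)
  lemma = solve-∀ ℚ-ring

best-sign : ∀ x → x * x ≤ 1ℚ → ∀ β → ∃ λ b → sign b * β ≤ x * β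
best-sign x p β with ℚ.≤-total 0ℚ β
... | inj₁ q = false , ≤-from (0≤* (0≤- (x²≤1⇒x≤1 (- x) (≤-trans (≤-reflexive (neg² x)) p))) q) (lemma x β)
  where
  neg² : ∀ x → (- x) * (- x) ≡ x * x
  neg² = solve-∀ ℚ-ring
  lemma : ∀ x β → x * β ≡ (- 1ℚ) * β + (1ℚ - (- x)) * β
  lemma = solve-∀ ℚ-ring
... | inj₂ q = true , ≤-from (0≤* (0≤- (x²≤1⇒x≤1 x p)) (0≤- q)) (lemma x β)
  where
  lemma : ∀ x β → x * β ≡ 1ℚ * β + (1ℚ - x) * (0ℚ - β)
  lemma = solve-∀ ℚ-ring

-- The linear part `l` makes the induction on the dimension close: freezing coordinate zero turns
-- its pair terms into a linear form in the others.
affine : ∀ {n} → (Fin n → ℚ) → (Fin n → Fin n → ℚ) → (Fin n → ℚ) → ℚ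
affine l A p = sum (λ i → l i * p i) + upper₂ (λ i j → A i j * (p i * p j))

affine-suc : ∀ {n} (l : Fin (suc n) → ℚ) A p → affine l A p ≡
  p zero * l zero + affine (λ i → l (suc i) + p zero * A zero (suc i)) (λ i j → A (suc i) (suc j)) (λ i → p (suc i))
affine-suc l A p = trans
  (cong (λ t → l zero * p zero + lin + (t + quad)) (sum-cong-≗ λ j → rearrange (A zero (suc j)) (p zero) (p (suc j))))
  (trans (lemma (l zero) (p zero) lin (sum λ j → p zero * A zero (suc j) * p (suc j)) quad)
    (cong (λ t → p zero * l zero + (t + quad)) (≡.sym
      (trans (sum-cong-≗ λ i → ℚ.*-distribʳ-+ (p (suc i)) (l (suc i)) (p zero * A zero (suc i)))
        (∑-distrib-+ (λ i → l (suc i) * p (suc i)) (λ i → p zero * A zero (suc i) * p (suc i)))))))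
  where
  lin quad : ℚ
  lin = sum λ i → l (suc i) * p (suc i)
  quad = upper₂ (λ i j → A (suc i) (suc j) * (p (suc i) * p (suc j)))
  rearrange : ∀ a x y → a * (x * y) ≡ x * a * y
  rearrange = solve-∀ ℚ-ring
  lemma : ∀ l p a b c → l * p + a + (b + c) ≡ p * l + (a + b + c)
  lemma = solve-∀ ℚ-ring

affine-slope : ∀ {n} (l a : Fin n → ℚ) A x q →
  affine (λ i → l i + x * a i) A q ≡ affine l A q + x * sum (λ i → a i * q i)
affine-slope l a A x q = trans
  (cong (_+ quad) (trans (sum-cong-≗ λ i → lemma (l i) x (a i) (q i)) (sum-linear 1 x (λ i → l i * q i) (λ i → a i * q i))))
  (collect (sum λ i → l i * q i) x (sum λ i → a i * q i) quad)
  where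
  quad = upper₂ (λ i j → A i j * (q i * q j))
  lemma : ∀ l x a q → (l + x * a) * q ≡ 1 * (l * q) + x * (a * q)
  lemma = solve-∀ ℚ-ring
  collect : ∀ b x c d → 1 * b + x * c + d ≡ b + d + x * c
  collect = solve-∀ ℚ-ring

-- Without diagonal terms the form is affine in each coordinate, so moving a coordinate to one of
-- the ends ±1 does not increase it.
round-to-signs : ∀ {n} (l : Fin n → ℚ) A p → (∀ v → p v * p v ≤ 1ℚ) →
  ∃ λ P → affine l A (signs P) ≤ affine l A p
round-to-signs {zero}  l A p bound = []ᵥ , ≤-refl
round-to-signs {suc n} l A p bound = proj₁ first ∷ᵥ Q , ≤-trans (≤-reflexive unfold)
  (≤-trans (ℚ.+-monoʳ-≤ base (proj₂ first))
  (≤-trans (≤-reflexive (trans (lemma base x (l zero) slope) (cong (x * l zero +_) (≡.sym (affine-slope l′ a A′ x (signs Q))))))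
  (≤-trans (ℚ.+-monoʳ-≤ (x * l zero) (proj₂ rest)) (≤-reflexive (≡.sym (affine-suc l A p))))))
  where
  x = p zero
  l′ a : Fin n → ℚ
  l′ i = l (suc i)
  a i = A zero (suc i)
  A′ : Fin n → Fin n → ℚ
  A′ i j = A (suc i) (suc j)
  -- The other coordinates are rounded while coordinate zero keeps its fractional value x; only then
  -- is its sign chosen, against the slope they determine.
  rest : ∃ λ Q → affine (λ i → l′ i + x * a i) A′ (signs Q) ≤ affine (λ i → l′ i + x * a i) A′ (λ i → p (suc i))
  rest = round-to-signs (λ i → l′ i + x * a i) A′ (λ i → p (suc i)) (λ v → bound (suc v))
  Q = proj₁ rest
  slope base : ℚ
  slope = sum λ i → a i * signs Q i
  base = affine l′ A′ (signs Q)
  first : ∃ λ b → sign b * (l zero + slope) ≤ x * (l zero + slope)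
  first = best-sign x (bound zero) (l zero + slope)
  lemma : ∀ b x l s → b + x * (l + s) ≡ x * l + (b + x * s)
  lemma = solve-∀ ℚ-ring
  unfold : affine l A (signs (proj₁ first ∷ᵥ Q)) ≡ base + sign (proj₁ first) * (l zero + slope)
  unfold = trans (affine-suc l A (signs (proj₁ first ∷ᵥ Q)))
    (trans (cong (sign (proj₁ first) * l zero +_) (affine-slope l′ a A′ (sign (proj₁ first)) (signs Q)))
      (≡.sym (lemma base (sign (proj₁ first)) (l zero) slope)))

affine-zero : ∀ {n} (A : Fin n → Fin n → ℚ) p → affine (λ _ → 0ℚ) A p ≡ upper₂ (λ i j → A i j * (p i * p j))
affine-zero A p = trans (cong (_+ upper₂ (λ i j → A i j * (p i * p j))) (sum-0* p)) (ℚ.+-identityˡ _)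

-- Graphs

fraction-* : ∀ m k → ((ℤ.+ m) / suc k) * ℕ→ℚ (suc k) ≡ ℕ→ℚ m
fraction-* m k = ℚ.toℚᵘ-injective (ℚᵘ.≃-trans (ℚ.toℚᵘ-homo-* q (ℕ→ℚ (suc k)))
  (ℚᵘ.≃-trans (ℚᵘ.*-cong (ℚ.toℚᵘ-fromℚᵘ (mkℚᵘ (ℤ.+ m) k)) (toℚᵘ-ℕ→ℚ (suc k)))
    (ℚᵘ.≃-trans (ℚᵘ.*≡* eq) (ℚᵘ.≃-sym (toℚᵘ-ℕ→ℚ m)))))
  where
  q : ℚ
  q = (ℤ.+ m) / suc k
  eq : (ℤ.+ m) ℤ.* (ℤ.+ suc k) ℤ.* (ℤ.+ 1) ≡ (ℤ.+ m) ℤ.* (ℤ.+ (suc k *ℕ 1))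
  eq = trans (ℤ.*-identityʳ _) (cong (λ j → (ℤ.+ m) ℤ.* (ℤ.+ j)) (≡.sym (ℕ.*-identityʳ (suc k))))

reciprocal : ∀ {n} → 1 ≤ℕ n → ∃ λ ι → 0ℚ ≤ ι × ι ≤ 1ℚ × ℕ→ℚ n * ι ≡ 1ℚ
reciprocal {suc k} 1≤n = ι , 0≤ι ,
  ≤-trans (≤-trans (≤-reflexive (≡.sym (ℚ.*-identityʳ ι))) (*-monoˡ ι 0≤ι (ℕ→ℚ-mono 1≤n))) (≤-reflexive (fraction-* 1 k)) ,
  trans (ℚ.*-comm (ℕ→ℚ (suc k)) ι) (fraction-* 1 k)
  where
  ι : ℚ
  ι = (ℤ.+ 1) / suc k
  0≤ι : 0ℚ ≤ ι
  0≤ι = ℚ.nonNegative⁻¹ ι {{ℚ.normalize-nonNeg 1 (suc k)}}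

∈-allPartitions : ∀ {n} (P : Partition n) → P ∈ allPartitions n
∈-allPartitions []ᵥ = here refl
∈-allPartitions (true  ∷ᵥ P) = ∈-++⁺ˡ (∈-map⁺ (true ∷ᵥ_) (∈-allPartitions P))
∈-allPartitions {suc n} (false ∷ᵥ P) =
  ∈-++⁺ʳ (mapₗ (true ∷ᵥ_) (allPartitions n)) (∈-map⁺ (false ∷ᵥ_) (∈-allPartitions P))

cut≤mc : ∀ {n} (G : Graph n) P → cut G P ≤ℕ mc G
cut≤mc {n} G P = go (∈-allPartitions P)
  where
  go : ∀ {Ps} → P ∈ Ps → cut G P ≤ℕ foldr (λ Q m → cut G Q ⊔ m) 0 Ps
  go (here refl) = ℕ.m≤m⊔n _ _
  go {Q ∷ _} (there i) = ℕ.≤-trans (go i) (ℕ.m≤n⊔m (cut G Q) _)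

module Weights {n} (G : Graph n) where

  a : Fin n → Fin n → ℚ
  a u v = indicator (adj G u v)

  a-sym : ∀ u v → a u v ≡ a v u
  a-sym u v = cong indicator (sym G u v)

  a-diag : ∀ v → a v v ≡ 0ℚ
  a-diag v = cong indicator (irrefl G v)

  degree-sum : ∀ v → ℕ→ℚ (degree G v) ≡ sum (a v)
  degree-sum v = ℕ→ℚ-sumF (λ u → 𝟙 (adj G v u))

  ℕ→ℚ-sumF² : ∀ (f : Fin n → Fin n → ℕ) → ℕ→ℚ (sumF λ i → sumF (f i)) ≡ sum λ i → sum λ j → ℕ→ℚ (f i j)
  ℕ→ℚ-sumF² f = trans (ℕ→ℚ-sumF (λ i → sumF (f i))) (sum-cong-≗ λ i → ℕ→ℚ-sumF (f i))

  edges-upper : ℕ→ℚ (edges G) ≡ upper₂ a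
  edges-upper = trans (ℕ→ℚ-sumF² (λ i j → 𝟙 (i <ᵇ j ∧ adj G i j)))
    (trans (sum-cong-≗ λ i → sum-cong-≗ λ j → indicator-∧ (i <ᵇ j) (adj G i j)) (upper₂-indicator a))

  cut-upper : ∀ P → ℕ→ℚ (cut G P) ≡ upper₂ λ i j → a i j * indicator (lookup P i xor lookup P j)
  cut-upper P = trans (ℕ→ℚ-sumF² (λ i j → 𝟙 (i <ᵇ j ∧ adj G i j ∧ (lookup P i xor lookup P j))))
    (trans (sum-cong-≗ λ i → sum-cong-≗ λ j →
      trans (indicator-∧ (i <ᵇ j) (adj G i j ∧ (lookup P i xor lookup P j)))
        (cong (indicator (i <ᵇ j) *_) (indicator-∧ (adj G i j) (lookup P i xor lookup P j))))
      (upper₂-indicator (λ i j → a i j * indicator (lookup P i xor lookup P j))))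

  upper-weighted : ∀ (B : Fin n → Fin n → ℚ) → (∀ i j → B i j ≡ B j i) → ⟪ a , B ⟫ ≡ 2 * upper₂ (λ i j → a i j * B i j)
  upper-weighted B B-sym = sum-upper₂ (λ i j → a i j * B i j) (λ i j → cong₂ _*_ (a-sym i j) (B-sym i j))
    (λ i → trans (cong (_* B i i) (a-diag i)) (ℚ.*-zeroˡ (B i i)))

  six-triangles : (sum λ i → sum λ j → sum λ k → a i j * (a j k * a i k)) ≡ 6 * ℕ→ℚ (triangles G)
  six-triangles = trans (sum-upper₃ F swap₁₂ swap₂₃ diag) (cong (6 *_) (≡.sym
    (trans (ℕ→ℚ-sumF² (λ i j → sumF λ k → 𝟙 (i <ᵇ j ∧ j <ᵇ k ∧ adj G i j ∧ adj G j k ∧ adj G i k)))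
    (trans (sum-cong-≗ λ i → sum-cong-≗ λ j → trans (ℕ→ℚ-sumF (λ k → 𝟙 (i <ᵇ j ∧ j <ᵇ k ∧ adj G i j ∧ adj G j k ∧ adj G i k)))
        (sum-cong-≗ λ k → trans (indicator-∧ (i <ᵇ j) (j <ᵇ k ∧ adj G i j ∧ adj G j k ∧ adj G i k)) (cong (indicator (i <ᵇ j) *_)
          (trans (indicator-∧ (j <ᵇ k) (adj G i j ∧ adj G j k ∧ adj G i k)) (cong (indicator (j <ᵇ k) *_)
          (trans (indicator-∧ (adj G i j) (adj G j k ∧ adj G i k)) (cong (a i j *_) (indicator-∧ (adj G j k) (adj G i k)))))))))
      (upper₃-indicator F)))))
    where
    F : Fin n → Fin n → Fin n → ℚ
    F i j k = a i j * (a j k * a i k)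
    swap₁₂ : ∀ i j k → F i j k ≡ F j i k
    swap₁₂ i j k = cong₂ _*_ (a-sym i j) (ℚ.*-comm (a j k) (a i k))
    swap₂₃ : ∀ i j k → F i j k ≡ F i k j
    swap₂₃ i j k = trans (cong (λ t → a i j * (t * a i k)) (a-sym j k)) (rearrange (a i j) (a k j) (a i k))
      where
      rearrange : ∀ x y z → x * (y * z) ≡ z * (y * x)
      rearrange = solve-∀ ℚ-ring
    diag : ∀ i k → F i i k ≡ 0ℚ
    diag i k = trans (cong (_* (a i k * a i k)) (a-diag i)) (ℚ.*-zeroˡ (a i k * a i k))

  indicator-xor : ∀ x y → indicator (x xor y) ≡ ½ * 1ℚ + (- ½) * (sign x * sign y)
  indicator-xor true  true  = refl
  indicator-xor true  false = refl
  indicator-xor false true  = refl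
  indicator-xor false false = refl

  cut-surplus : ∀ P → ℕ→ℚ (cut G P) ≡ ½ * ℕ→ℚ (edges G) - ½ * upper₂ (λ i j → a i j * (signs P i * signs P j))
  cut-surplus P = trans (halve (ℕ→ℚ (cut G P))) (trans (cong (½ *_) doubled)
    (collect (ℕ→ℚ (edges G)) (upper₂ λ i j → a i j * (signs P i * signs P j))))
    where
    xor-form : ⟪ a , (λ i j → indicator (lookup P i xor lookup P j)) ⟫ ≡
      ½ * ⟪ a , (λ _ _ → 1ℚ) ⟫ + (- ½) * ⟪ a , (λ i j → signs P i * signs P j) ⟫
    xor-form = trans (⟪⟫-cong a λ i j → indicator-xor (lookup P i) (lookup P j))
      (⟪⟫-linear a ½ (- ½) (λ _ _ → 1ℚ) (λ i j → signs P i * signs P j))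
    xor-sym : ∀ x y → indicator (x xor y) ≡ indicator (y xor x)
    xor-sym x y = trans (indicator-xor x y) (trans (cong (λ t → ½ * 1ℚ + (- ½) * t) (ℚ.*-comm (sign x) (sign y)))
      (≡.sym (indicator-xor y x)))
    doubled : 2 * ℕ→ℚ (cut G P) ≡ ½ * (2 * ℕ→ℚ (edges G)) + (- ½) * (2 * upper₂ (λ i j → a i j * (signs P i * signs P j)))
    doubled = trans (cong (2 *_) (cut-upper P))
      (trans (≡.sym (upper-weighted (λ i j → indicator (lookup P i xor lookup P j)) (λ i j → xor-sym (lookup P i) (lookup P j))))
      (trans xor-form (cong₂ (λ x y → ½ * x + (- ½) * y)
        (trans (sum-cong-≗ λ i → sum-cong-≗ λ j → ℚ.*-identityʳ (a i j))
          (trans (sum-upper₂ a a-sym a-diag) (cong (2 *_) (≡.sym edges-upper))))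
        (upper-weighted (λ i j → signs P i * signs P j) (λ i j → ℚ.*-comm (signs P i) (signs P j))))))
    halve : ∀ x → x ≡ ½ * (2 * x)
    halve = solve-∀ ℚ-ring
    collect : ∀ e u → ½ * (½ * (2 * e) + (- ½) * (2 * u)) ≡ ½ * e - ½ * u
    collect = solve-∀ ℚ-ring

  surplus≥ : ∀ p → (∀ v → p v * p v ≤ 1ℚ) → - (½ * ½) * ⟪ a , (λ u v → p u * p v) ⟫ ≤ sp G
  surplus≥ p bound = ≤-trans (≤-reflexive (trans (cong (- (½ * ½) *_) (upper-weighted (λ u v → p u * p v) (λ u v → ℚ.*-comm (p u) (p v))))
      (quarter U)))
    (≤-from (0≤+ (0≤* {½} ≤-decide (0≤- V≤U)) (0≤- (ℕ→ℚ-mono (cut≤mc G P))))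
      (trans (cong (λ t → ℕ→ℚ (mc G) - t) edges-half)
        (trans (lemma (ℕ→ℚ (mc G)) (ℕ→ℚ (edges G)) U V)
          (cong (λ t → - ½ * U + (½ * (U - V) + (ℕ→ℚ (mc G) - t))) (≡.sym (cut-surplus P))))))
    where
    U = upper₂ λ i j → a i j * (p i * p j)
    rounded = round-to-signs (λ _ → 0ℚ) a p bound
    P = proj₁ rounded
    V = upper₂ λ i j → a i j * (signs P i * signs P j)
    V≤U : V ≤ U
    V≤U = ≤-trans (≤-reflexive (≡.sym (affine-zero a (signs P)))) (≤-trans (proj₂ rounded) (≤-reflexive (affine-zero a p)))
    quarter : ∀ u → - (½ * ½) * (2 * u) ≡ - ½ * u
    quarter = solve-∀ ℚ-ring
    half : ∀ x y → x * 2 ≡ y → x ≡ ½ * y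
    half x y e = trans (double x) (cong (½ *_) e)
      where
      double : ∀ x → x ≡ ½ * (x * 2)
      double = solve-∀ ℚ-ring
    edges-half : (ℤ.+ edges G) / 2 ≡ ½ * ℕ→ℚ (edges G)
    edges-half = half ((ℤ.+ edges G) / 2) (ℕ→ℚ (edges G)) (fraction-* (edges G) 1)
    lemma : ∀ m e u v → m - ½ * e ≡ - ½ * u + (½ * (u - v) + (m - (½ * e - ½ * v)))
    lemma = solve-∀ ℚ-ring

module Regular {n} (G : Graph n) (d : ℕ) (regular : IsRegular G d)
               (ι : ℚ) (0≤ι : 0ℚ ≤ ι) (ι≤1 : ι ≤ 1ℚ) (Dι≡1 : ℕ→ℚ d * ι ≡ 1ℚ)
               (ρ : ℚ) (nρ≡1 : ℕ→ℚ n * ρ ≡ 1ℚ) where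

  open Weights G

  private
    D : ℚ
    D = ℕ→ℚ d

    K : Fin n → Fin n → ℚ
    K u v = ι * a u v

    K-sym : ∀ u v → K u v ≡ K v u
    K-sym u v = cong (ι *_) (a-sym u v)

    a-row : ∀ v → sum (a v) ≡ D
    a-row v = trans (≡.sym (degree-sum v)) (cong ℕ→ℚ (regular v))

    row-sum : ∀ u → sum (K u) ≡ 1ℚ
    row-sum u = trans (≡.sym (*-distribˡ-sum ι (a u))) (trans (cong (ι *_) (a-row u)) (trans (ℚ.*-comm ι D) Dι≡1))

    K-diag : ∀ v → K v v ≡ 0ℚ
    K-diag v = trans (cong (ι *_) (a-diag v)) (ℚ.*-zeroʳ ι)

    K≤ι : ∀ u v → K u v ≤ ι
    K≤ι u v = ≤-trans (*-monoˡ ι 0≤ι (indicator≤1 (adj G u v))) (≤-reflexive (ℚ.*-identityʳ ι))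

    row-sum² : ∀ v → sum (λ u → K u v * K u v) ≡ ι
    row-sum² v = trans (sum-cong-≗ λ u → trans (cong₂ _*_ (K-sym u v) (K-sym u v))
        (trans (rearrange ι (a v u)) (trans (cong (ι * ι *_) (indicator² (adj G v u))) (ℚ.*-assoc ι ι (a v u)))))
      (trans (≡.sym (*-distribˡ-sum ι (K v))) (trans (cong (ι *_) (row-sum v)) (ℚ.*-identityʳ ι)))
      where
      rearrange : ∀ ι x → ι * x * (ι * x) ≡ ι * ι * (x * x)
      rearrange = solve-∀ ℚ-ring

  open Spectral K K-sym (λ u v → 0≤* 0≤ι (0≤indicator (adj G u v))) row-sum K-diag ι K≤ι row-sum² ρ nρ≡1

  deviation slackness : ℚ
  deviation = trace₃ - 1
  slackness = sum slack

  trace₃-triangles : trace₃ ≡ ι * ι * ι * (6 * ℕ→ℚ (triangles G))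
  trace₃-triangles = trans
    (sum-cong-≗ λ v → trans (sum-cong-≗ λ u → trans (cong₂ _*_ (sum-cong-≗ λ w → cong (K u w *_) (e₁-eq v w)) (e₁-eq v u))
        (trans (ℚ.*-comm (sum λ w → K u w * K w v) (K u v))
          (trans (*-distribˡ-sum (K u v) (λ w → K u w * K w v))
            (trans (sum-cong-≗ λ w → trans (rearrange ι (a u v) (a u w) (a w v)) (cong₂ (λ x y → ι * ι * ι * (x * (a u w * y))) (a-sym u v) (a-sym w v)))
              (≡.sym (*-distribˡ-sum (ι * ι * ι) (λ w → a v u * (a u w * a v w))))))))
      (≡.sym (*-distribˡ-sum (ι * ι * ι) (λ u → sum λ w → a v u * (a u w * a v w)))))
    (trans (≡.sym (*-distribˡ-sum (ι * ι * ι) (λ v → sum λ u → sum λ w → a v u * (a u w * a v w))))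
      (cong (ι * ι * ι *_) six-triangles))
    where
    rearrange : ∀ ι x y z → ι * x * (ι * y * (ι * z)) ≡ ι * ι * ι * (x * (y * z))
    rearrange = solve-∀ ℚ-ring

  deviation-s : deviation ≡ ι * ι * ι * (6 * sParam G d)
  deviation-s = trans (cong (_- 1ℚ) trace₃-triangles)
    (trans (cong (λ t → ι * ι * ι * (6 * T) - t) (≡.sym cubed)) (factor (ι * ι * ι) T ((ℤ.+ (d *ℕ d *ℕ d)) / 6)))
    where
    T = ℕ→ℚ (triangles G)
    factor : ∀ c t q → c * (6 * t) - c * (q * 6) ≡ c * (6 * (t - q))
    factor = solve-∀ ℚ-ring
    regroup : ∀ ι D → ι * ι * ι * (D * D * D) ≡ D * ι * (D * ι) * (D * ι)
    regroup = solve-∀ ℚ-ring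
    cubed : ι * ι * ι * (((ℤ.+ (d *ℕ d *ℕ d)) / 6) * 6) ≡ 1ℚ
    cubed = trans (cong (ι * ι * ι *_) (trans (fraction-* (d *ℕ d *ℕ d) 5)
        (trans (ℕ→ℚ-* (d *ℕ d) d) (cong (_* D) (ℕ→ℚ-* d d)))))
      (trans (regroup ι D) (cong (λ t → t * t * t) Dι≡1))

  -- The factor 1/16 is ¼ from `surplus≥` times ¼ from halving J: J² ≤ 2 places ½J inside [-1, 1].
  surplus-bound : ∀ h → h * h * ι ≤ 1ℚ →
    δ * δ * (½ * ½ * ½ * ½) * (D * (½ * (ℕ→ℚ n * ι) + 2 * h * slackness - h * h * deviation)) ≤ sp G
  surplus-bound h h²ι≤1 = ≤-trans (≤-from (0≤* {½ * ½ * ½ * ½} ≤-decide (0≤* (ℕ→ℚ-nonneg d) (0≤- (proj₂ (proj₂ outcome)))))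
      (trans (cong (- (½ * ½) *_) scaled) (lemma (δ * δ) D (½ * (ℕ→ℚ n * ι) + 2 * h * slackness - h * h * deviation) Q)))
    (surplus≥ p p-bound)
    where
    outcome = spectral-rounding h 0≤ι ι≤1 h²ι≤1 (256 *ℕ d)
      (trans (cong (_* (ι * (δ * (½ * ½ * ½)))) (ℕ→ℚ-* 256 d)) (trans (cancel D ι) Dι≡1))
      where
      cancel : ∀ D ι → 256 * D * (ι * (δ * (½ * ½ * ½))) ≡ D * ι
      cancel = solve-∀ ℚ-ring
    J = proj₁ outcome
    Q = ⟪ K , (λ u v → J u * J v) ⟫
    p : Fin n → ℚ
    p v = ½ * J v
    p-bound : ∀ v → p v * p v ≤ 1ℚ
    p-bound v = ≤-trans (≤-reflexive (quarter (J v))) (≤-trans (*-monoˡ (½ * ½) ≤-decide (proj₁ (proj₂ outcome) v)) ≤-decide)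
      where
      quarter : ∀ x → ½ * x * (½ * x) ≡ ½ * ½ * (x * x)
      quarter = solve-∀ ℚ-ring
    scaled : ⟪ a , (λ u v → p u * p v) ⟫ ≡ ½ * ½ * (D * Q)
    scaled = trans (sum-cong-≗ λ u → trans
        (sum-cong-≗ λ v → trans (cong (_* (p u * p v)) (trans (≡.sym (ℚ.*-identityˡ (a u v))) (cong (_* a u v) (≡.sym Dι≡1))))
          (rearrange D ι (a u v) (J u) (J v)))
        (≡.sym (*-distribˡ-sum (½ * ½ * D) (λ v → K u v * (J u * J v)))))
      (trans (≡.sym (*-distribˡ-sum (½ * ½ * D) (λ u → sum λ v → K u v * (J u * J v)))) (ℚ.*-assoc (½ * ½) D Q))
      where
      rearrange : ∀ D ι x y z → D * ι * x * (½ * y * (½ * z)) ≡ ½ * ½ * D * (ι * x * (y * z))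
      rearrange = solve-∀ ℚ-ring
    lemma : ∀ c D B Q → - (½ * ½) * (½ * ½ * (D * Q)) ≡ c * (½ * ½ * ½ * ½) * (D * B) + ½ * ½ * ½ * ½ * (D * (- c * B - Q))
    lemma = solve-∀ ℚ-ring

  slackness-nonneg : 0ℚ ≤ slackness
  slackness-nonneg = sum-slack-nonneg

  slackness≥ : ℕ→ℚ n * ι - 2 * deviation - 1 ≤ slackness
  slackness≥ = ≤-trans (≤-reflexive (lemma (ℕ→ℚ n * ι) trace₃)) sum-slack≥
    where
    lemma : ∀ ν t → ν - 2 * (t - 1) - 1 ≡ ν - 2 * t + 1
    lemma = solve-∀ ℚ-ring

-- The three ranges

-- Induction on d: r is kept while 4r² still reaches the new value and is doubled otherwise. The
-- lost factor 4 goes into the constants.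
rational-sqrt : ∀ d → 1 ≤ℕ d → ∃ λ r → 0ℚ ≤ r × r * r ≤ ℕ→ℚ d × ℕ→ℚ d ≤ 4 * (r * r)
rational-sqrt (suc zero)      _ = 1ℚ , ≤-decide , ≤-decide , ≤-decide
rational-sqrt (suc d@(suc _)) _ with rational-sqrt d (s≤s z≤n)
... | r , 0≤r , r²≤d , d≤4r² with ℚ.≤-total (ℕ→ℚ (suc d)) (4 * (r * r))
...   | inj₁ p = r , 0≤r , ≤-trans r²≤d (ℕ→ℚ-mono (ℕ.n≤1+n d)) , p
...   | inj₂ p = 2 * r , 0≤* {2} ≤-decide 0≤r , ≤-trans (≤-reflexive (double r)) p ,
  ≤-trans (≤-reflexive (ℕ→ℚ-+ 1 d)) (≤-from
    (0≤+ (0≤+ (0≤- (ℕ→ℚ-mono {1} {d} (s≤s z≤n))) (0≤* {2} ≤-decide (0≤- d≤4r²))) (0≤* {8} ≤-decide (0≤² r)))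
    (lemma r (ℕ→ℚ d)))
  where
  double : ∀ r → 2 * r * (2 * r) ≡ 4 * (r * r)
  double = solve-∀ ℚ-ring
  lemma : ∀ r D → 4 * (2 * r * (2 * r)) ≡ 1 + D + ((D - 1) + 2 * (4 * (r * r) - D) + 8 * (r * r))
  lemma = solve-∀ ℚ-ring

x²≤y²⇒x≤y : ∀ x y → 0ℚ ≤ y → x * x ≤ y * y → x ≤ y
x²≤y²⇒x≤y x y 0≤y p with ℚ.≤-total x y
... | inj₁ q = q
... | inj₂ q with x ℚ.≟ y
...   | yes e = ≤-reflexive e
...   | no x≢y = ⊥-elim (ℚ.<-irrefl refl (ℚ.<-≤-trans y²<x² p))
  where
  y<x : y < x
  y<x = ℚ.≰⇒> λ x≤y → x≢y (ℚ.≤-antisym x≤y q)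
  y²<x² : y * y < x * x
  y²<x² = ℚ.≤-<-trans (ℚ.*-monoˡ-≤-nonNeg y {{nonNegative 0≤y}} q)
    (ℚ.*-monoˡ-<-pos x {{positive (ℚ.≤-<-trans 0≤y y<x)}} y<x)

-- 2⁻²²
c₀ : ℚ
c₀ = δ * δ * (½ * ½ * ½ * ½) * (½ * ½ * ½ * ½ * ½ * ½ * ½ * ½)

-- 48 = 8 · 6, where 8 comes from the condition 8hS ≤ ν of `linear-bound` and 6 from S = 6s/d³.
θ : ℚ
θ = (ℤ.+ 1) / 48

-- D, ι, N, s are d, 1/d, n and the triangle excess; S and Y are the excess of tr (A/d)³ over 1
-- and the quantity tr (A/d)²(I - A/d)².
module Ranges (D ι N s S Y σ c : ℚ) (0≤c : 0ℚ ≤ c) (Dι≡1 : D * ι ≡ 1ℚ) (0≤D : 0ℚ ≤ D) (0≤ι : 0ℚ ≤ ι) (2D≤N : 2 * D ≤ N)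
              (S-s : S ≡ ι * ι * ι * (6 * s)) (0≤Y : 0ℚ ≤ Y) (Y≥ : N * ι - 2 * S - 1 ≤ Y)
              (bound : ∀ h → h * h * ι ≤ 1ℚ → 256 * c * (D * (½ * (N * ι) + 2 * h * Y - h * h * S)) ≤ σ) where

  ν : ℚ
  ν = N * ι

  0≤N : 0ℚ ≤ N
  0≤N = ≤-trans (0≤* {2} ≤-decide 0≤D) 2D≤N

  0≤ν : 0ℚ ≤ ν
  0≤ν = 0≤* 0≤N 0≤ι

  2≤ν : 2 ≤ ν
  2≤ν = ≤-trans (≤-reflexive (trans (cong (2 *_) (≡.sym Dι≡1)) (lemma D ι)))
    (≤-trans (*-monoˡ ι 0≤ι 2D≤N) (≤-reflexive (ℚ.*-comm ι N)))
    where
    lemma : ∀ D ι → 2 * (D * ι) ≡ ι * (2 * D)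
    lemma = solve-∀ ℚ-ring

  Dν≡N : D * ν ≡ N
  Dν≡N = trans (lemma D N ι) (trans (cong (_* N) Dι≡1) (ℚ.*-identityˡ N))
    where
    lemma : ∀ D N ι → D * (N * ι) ≡ D * ι * N
    lemma = solve-∀ ℚ-ring

  -- The assumption d ≤ n/2 enters here: ν = n/d ≥ 2 lets half of ν absorb the 1 left by the trivial
  -- eigenvalue.
  ½ν-2S≤Y : ½ * ν - 2 * S ≤ Y
  ½ν-2S≤Y = ≤-trans (≤-from (0≤* {½} ≤-decide (0≤- 2≤ν)) (lemma ν S)) Y≥
    where
    lemma : ∀ ν S → ν - 2 * S - 1 ≡ ½ * ν - 2 * S + ½ * (ν - 2)
    lemma = solve-∀ ℚ-ring

  -- The bracket is at least (3/8)hν, and 256 · 3/8 = 96. The loss h²S costs at most hν/8. If 8S ≤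
  -- ν, then 2hY ≥ hν - 4hS ≥ ½hν. If ν ≤ 8S, then hν ≤ 8hS ≤ ν, so the term ½ν alone gives ½hν.
  linear-bound : ∀ h → 0ℚ ≤ h → h * h * ι ≤ 1ℚ → 8 * (h * S) ≤ ν → 96 * c * (h * N) ≤ σ
  linear-bound h 0≤h h²ι≤1 8hS≤ν = ≤-trans
    (≤-trans (≤-reflexive (trans (cong (λ x → 96 * c * (h * x)) (≡.sym Dν≡N)) (regroup c h D ν)))
      (*-monoˡ (256 * c) (0≤* {256} ≤-decide 0≤c) (*-monoˡ D 0≤D (core (ℚ.≤-total (8 * S) ν)))))
    (bound h h²ι≤1)
    where
    regroup : ∀ c h D ν → 96 * c * (h * (D * ν)) ≡ 256 * c * (D * (½ * ½ * ½ * 3 * (h * ν)))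
    regroup = solve-∀ ℚ-ring
    core : (8 * S ≤ ν ⊎ ν ≤ 8 * S) → ½ * ½ * ½ * 3 * (h * ν) ≤ ½ * ν + 2 * h * Y - h * h * S
    core (inj₁ p) = ≤-from (0≤+ (0≤+ (0≤+ (0≤* {½} ≤-decide 0≤ν) (0≤* (0≤* {2} ≤-decide 0≤h) (0≤- ½ν-2S≤Y)))
        (0≤* (0≤* {½} ≤-decide 0≤h) (0≤- p))) (0≤* (0≤* {½ * ½ * ½} ≤-decide 0≤h) (0≤- 8hS≤ν))) (lemma h ν S Y)
      where
      lemma : ∀ h ν S Y → ½ * ν + 2 * h * Y - h * h * S ≡ ½ * ½ * ½ * 3 * (h * ν) +
        (½ * ν + 2 * h * (Y - (½ * ν - 2 * S)) + ½ * h * (ν - 8 * S) + ½ * ½ * ½ * h * (ν - 8 * (h * S)))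
      lemma = solve-∀ ℚ-ring
    core (inj₂ p) = ≤-from (0≤+ (0≤+ (0≤* (0≤* {2} ≤-decide 0≤h) 0≤Y) (0≤* (0≤* {½ * ½ * ½} ≤-decide 0≤h) (0≤- 8hS≤ν)))
        (0≤* {½} ≤-decide (0≤+ (0≤- 8hS≤ν) (0≤* 0≤h (0≤- p))))) (lemma h ν S Y)
      where
      lemma : ∀ h ν S Y → ½ * ν + 2 * h * Y - h * h * S ≡ ½ * ½ * ½ * 3 * (h * ν) +
        (2 * h * Y + ½ * ½ * ½ * h * (ν - 8 * (h * S)) + ½ * ((ν - 8 * (h * S)) + h * (8 * S - ν)))
      lemma = solve-∀ ℚ-ring

  D³S : D * D * D * S ≡ 6 * s
  D³S = trans (cong (D * D * D *_) S-s) (trans (lemma D ι s) (trans (cong (λ x → x * x * x * (6 * s)) Dι≡1) (ℚ.*-identityˡ (6 * s))))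
    where
    lemma : ∀ D ι s → D * D * D * (ι * ι * ι * (6 * s)) ≡ D * ι * (D * ι) * (D * ι) * (6 * s)
    lemma = solve-∀ ℚ-ring

  module _ (r : ℚ) (0≤r : 0ℚ ≤ r) (r²≤D : r * r ≤ D) (D≤4r² : D ≤ 4 * (r * r)) where

    r²ι≤1 : r * r * ι ≤ 1ℚ
    r²ι≤1 = ≤-trans (≤-reflexive (ℚ.*-comm (r * r) ι)) (≤-trans (*-monoˡ ι 0≤ι r²≤D)
      (≤-reflexive (trans (ℚ.*-comm ι D) Dι≡1)))

    -- With h = r and S negative, -r²S ≥ -DS/4 is the main term. Multiplied by 256cD² and with D³S =
    -- 6s it gives 384c|s|, of which 383c|s| is discarded.
    range₁ : s < 0ℚ → c * ∣ s ∣ ≤ D * σ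
    range₁ s<0 = ≤-trans (≤-reflexive (cong (c *_) abs))
      (≤-from (0≤+ (0≤+ (0≤+ (0≤* 0≤D (0≤- (bound r r²ι≤1)))
          (0≤* (0≤* {256} ≤-decide 0≤c) (0≤* (0≤² D) (0≤+ (0≤* {½} ≤-decide 0≤ν) (0≤* (0≤* {2} ≤-decide 0≤r) 0≤Y)))))
          (0≤* (0≤* {64} ≤-decide 0≤c) (0≤* (0≤* (0≤² D) (0≤- D≤4r²)) 0≤-S)))
          (0≤* (0≤* {383} ≤-decide 0≤c) 0≤-s))
        -- The relation D³S = 6s is fed to the ring identity as a summand 64c(6s - D³S), which is
        -- then replaced by 0.
        (trans (lemma c D σ ν Y S r s)
          (trans (cong (λ x → total + 64 * c * x) (trans (cong (λ x → 6 * s - x) D³S) (ℚ.+-inverseʳ (6 * s)))) (drop total c))))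
      where
      total : ℚ
      total = c * - s + (D * (σ - 256 * c * (D * (½ * ν + 2 * r * Y - r * r * S)))
        + 256 * c * (D * D * (½ * ν + 2 * r * Y)) + 64 * c * (D * D * (4 * (r * r) - D) * - S) + 383 * c * - s)
      drop : ∀ x c → x + 64 * c * 0ℚ ≡ x
      drop = solve-∀ ℚ-ring
      0≤-s : 0ℚ ≤ - s
      0≤-s = ℚ.neg-antimono-≤ (ℚ.<⇒≤ s<0)
      0≤-S : 0ℚ ≤ - S
      0≤-S = ≤-trans (0≤* (0≤* (0≤* 0≤ι 0≤ι) 0≤ι) (0≤* {6} ≤-decide 0≤-s))
        (≤-reflexive (trans (negate (ι * ι * ι) s) (cong -_ (≡.sym S-s))))
        where
        negate : ∀ x s → x * (6 * - s) ≡ - (x * (6 * s))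
        negate = solve-∀ ℚ-ring
      abs : ∣ s ∣ ≡ - s
      abs = trans (≡.sym (ℚ.∣-p∣≡∣p∣ s)) (ℚ.0≤p⇒∣p∣≡p 0≤-s)
      lemma : ∀ c D σ ν Y S r s → D * σ ≡ c * - s + (D * (σ - 256 * c * (D * (½ * ν + 2 * r * Y - r * r * S)))
        + 256 * c * (D * D * (½ * ν + 2 * r * Y)) + 64 * c * (D * D * (4 * (r * r) - D) * - S) + 383 * c * - s)
        + 64 * c * (6 * s - D * D * D * S)
      lemma = solve-∀ ℚ-ring

    -- Here h = θr. From r² ≤ D and the bound on s² follows rS ≤ 6ν, so 8hS ≤ ν. As 96θ = 2, this
    -- gives σ ≥ 2crN, whose square is at least c²N²D because 4r² ≥ D.
    range₂ : s * s ≤ N * N * (D * D * D) → 0ℚ ≤ σ × c * c * (N * N * D) ≤ σ * σ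
    range₂ s²≤ = ≤-trans 0≤low low≤σ ,
      ≤-trans (≤-from (0≤* (0≤² c) (0≤* (0≤² N) (0≤- D≤4r²))) (square c N r D))
        (*-mono 0≤low (≤-trans 0≤low low≤σ) low≤σ low≤σ)
      where
      low : ℚ
      low = 96 * c * (θ * r * N)
      0≤low : 0ℚ ≤ low
      0≤low = 0≤* (0≤* {96} ≤-decide 0≤c) (0≤* (0≤* {θ} ≤-decide 0≤r) 0≤N)
      square : ∀ c N r D → 96 * c * (θ * r * N) * (96 * c * (θ * r * N)) ≡
        c * c * (N * N * D) + c * c * (N * N * (4 * (r * r) - D))
      square = solve-∀ ℚ-ring
      DS²≤ : r * S * (r * S) ≤ 6 * ν * (6 * ν)
      DS²≤ = ≤-trans (≤-reflexive (regroup r S)) (≤-trans (*-mono (0≤² r) (0≤² S) r²≤D ≤-refl)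
        (≤-trans (≤-reflexive (trans (cong (λ x → D * (x * x)) S-s) (expand D ι s)))
          (≤-trans (*-monoˡ (36 * (D * (ι * ι * ι * (ι * ι * ι)))) (0≤* {36} ≤-decide (0≤* 0≤D (0≤² (ι * ι * ι)))) s²≤)
            (≤-reflexive (trans (collect D ι N) (trans (cong (λ x → x * x * (x * x) * (6 * ν * (6 * ν))) Dι≡1) (ℚ.*-identityˡ (6 * ν * (6 * ν)))))))))
        where
        regroup : ∀ r S → r * S * (r * S) ≡ r * r * (S * S)
        regroup = solve-∀ ℚ-ring
        expand : ∀ D ι s → D * (ι * ι * ι * (6 * s) * (ι * ι * ι * (6 * s))) ≡ 36 * (D * (ι * ι * ι * (ι * ι * ι))) * (s * s)
        expand = solve-∀ ℚ-ring
        collect : ∀ D ι N → 36 * (D * (ι * ι * ι * (ι * ι * ι))) * (N * N * (D * D * D)) ≡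
          D * ι * (D * ι) * (D * ι * (D * ι)) * (6 * (N * ι) * (6 * (N * ι)))
        collect = solve-∀ ℚ-ring
      low≤σ : low ≤ σ
      low≤σ = linear-bound (θ * r) (0≤* {θ} ≤-decide 0≤r)
        (≤-trans (≤-reflexive (regroup r ι)) (≤-trans (*-monoˡ (θ * θ) ≤-decide r²ι≤1) ≤-decide))
        (≤-trans (≤-reflexive (rescale r S)) (≤-trans
          (*-monoˡ (8 * θ) ≤-decide (x²≤y²⇒x≤y (r * S) (6 * ν) (0≤* {6} ≤-decide 0≤ν) DS²≤))
          (≤-reflexive (unscale ν))))
        where
        regroup : ∀ r ι → θ * r * (θ * r) * ι ≡
          θ * θ * (r * r * ι)
        regroup = solve-∀ ℚ-ring
        rescale : ∀ r S → 8 * (θ * r * S) ≡ 8 * θ * (r * S)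
        rescale = solve-∀ ℚ-ring
        unscale : ∀ ν → 8 * θ * (6 * ν) ≡ ν
        unscale = solve-∀ ℚ-ring

  range₃ : 0ℚ < s → N * N * (D * D * D) < s * s → c * (N * N * (D * D)) ≤ s * σ
  range₃ 0<s B²<s² = ≤-trans
    -- As 96θ = 2, the choice of h yields twice the required bound.
    (≤-from (0≤* 0≤c (0≤* (0≤² N) (0≤² D))) (lemma c N D))
    (≤-trans (≤-reflexive (trans (cong (λ x → 2 * c * (N * N * (D * D)) * x) (≡.sym sς≡1)) (regroup c N D s ς)))
      (*-monoˡ s (ℚ.<⇒≤ 0<s) (linear-bound h 0≤h h²ι≤1 (≤-reflexive 8hS≡ν))))
    where
    instance
      s-pos = positive 0<s
      s-nonZero = ℚ.pos⇒nonZero s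
    ς : ℚ
    ς = 1/ s
    sς≡1 : s * ς ≡ 1ℚ
    sς≡1 = ℚ.*-inverseʳ s
    0≤ς : 0ℚ ≤ ς
    0≤ς = ℚ.<⇒≤ (ℚ.positive⁻¹ ς {{ℚ.1/pos⇒pos s}})
    -- Chosen so that h S = ν / 8.
    h : ℚ
    h = θ * (N * (D * D) * ς)
    0≤h : 0ℚ ≤ h
    0≤h = 0≤* {θ} ≤-decide (0≤* (0≤* 0≤N (0≤² D)) 0≤ς)
    lemma : ∀ c N D → 2 * c * (N * N * (D * D)) * 1ℚ ≡ c * (N * N * (D * D)) + c * (N * N * (D * D))
    lemma = solve-∀ ℚ-ring
    regroup : ∀ c N D s ς → 2 * c * (N * N * (D * D)) * (s * ς) ≡ s * (96 * c * (θ * (N * (D * D) * ς) * N))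
    regroup = solve-∀ ℚ-ring
    -- Using Dι = 1, h²ι = θ²N²D³/s², so the lower limit on s in this range keeps h admissible.
    h²ι≤1 : h * h * ι ≤ 1ℚ
    h²ι≤1 = ≤-trans (≤-reflexive (trans (split N D ι ς) (trans (cong (λ x → x * (θ * θ * (ς * ς) * (N * N * (D * D * D)))) Dι≡1) (ℚ.*-identityˡ (θ * θ * (ς * ς) * (N * N * (D * D * D)))))))
      (≤-trans (*-monoˡ (θ * θ * (ς * ς)) (0≤* {θ * θ} ≤-decide (0≤² ς)) (ℚ.<⇒≤ B²<s²))
        (≤-trans (≤-reflexive (trans (merge s ς) (cong (λ x → θ * θ * (x * x)) sς≡1))) ≤-decide))
      where
      split : ∀ N D ι ς → θ * (N * (D * D) * ς) * (θ * (N * (D * D) * ς)) * ι ≡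
        D * ι * (θ * θ * (ς * ς) * (N * N * (D * D * D)))
      split = solve-∀ ℚ-ring
      merge : ∀ s ς → θ * θ * (ς * ς) * (s * s) ≡
        θ * θ * (s * ς * (s * ς))
      merge = solve-∀ ℚ-ring
    8hS≡ν : 8 * (h * S) ≡ ν
    8hS≡ν = trans (cong (λ x → 8 * (h * x)) S-s) (trans (split N D ι s ς)
      (trans (cong₂ (λ x y → x * x * y * ν) Dι≡1 sς≡1) (ℚ.*-identityˡ ν)))
      where
      split : ∀ N D ι s ς → 8 * (θ * (N * (D * D) * ς) * (ι * ι * ι * (6 * s))) ≡
        D * ι * (D * ι) * (s * ς) * (N * ι)
      split = solve-∀ ℚ-ring

double≤ : ∀ d n → 2 *ℕ d ≤ℕ n → 2 * ℕ→ℚ d ≤ ℕ→ℚ n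
double≤ d n p = subst (_≤ ℕ→ℚ n) (ℕ→ℚ-* 2 d) (ℕ→ℚ-mono p)

theorem1p3 : ∃ λ (c : ℚ) → 0ℚ < c ×
    (∀ (n d : ℕ) (G : Graph n) → 1 ≤ℕ d → 2 *ℕ d ≤ℕ n → IsRegular G d →
      let s  = sParam G d
          N  = ℕ→ℚ n
          D  = ℕ→ℚ d
          B² = N * N * (D * D * D)
      in
      -- (i)  s < - n d^{3/2}   ⇒  sp(G) ≥ c |s| / d
      ((s < 0ℚ × B² < s * s) → c * ∣ s ∣ ≤ D * sp G)
      -- (ii) |s| ≤ n d^{3/2}   ⇒  sp(G) ≥ c n d^{1/2}
      × (s * s ≤ B² → (0ℚ ≤ sp G × c * c * (N * N * D) ≤ sp G * sp G))
      -- (iii) s > n d^{3/2}    ⇒  sp(G) ≥ c n^2 d^2 / s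
      × ((0ℚ < s × B² < s * s) → c * (N * N * (D * D)) ≤ s * sp G))
theorem1p3 = c₀ , ℚ.positive⁻¹ c₀ , λ n d G 1≤d 2d≤n regular →
  let ι , 0≤ι , ι≤1 , Dι≡1 = reciprocal 1≤d
      ρ , _ , _ , nρ≡1 = reciprocal (ℕ.≤-trans 1≤d (ℕ.≤-trans (ℕ.m≤m+n d (1 *ℕ d)) 2d≤n))
      r , 0≤r , r²≤D , D≤4r² = rational-sqrt d 1≤d
      open Regular G d regular ι 0≤ι ι≤1 Dι≡1 ρ nρ≡1
      open Ranges (ℕ→ℚ d) ι (ℕ→ℚ n) (sParam G d) deviation slackness (sp G) c₀ ≤-decide Dι≡1 (ℕ→ℚ-nonneg d) 0≤ι
        (double≤ d n 2d≤n) deviation-s slackness-nonneg slackness≥ surplus-bound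
  in (λ (s<0 , _) → range₁ r 0≤r r²≤D D≤4r² s<0) ,
     range₂ r 0≤r r²≤D D≤4r² ,
     λ (0<s , B²<s²) → range₃ 0<s B²<s²
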